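{- Let $n$, $2s$, $\delta$ and $\ell$ be positive integers with $n \geq 2s+1\geq 5$ and $\ell\geq 2$ (so $s$ is an integer or a half-integer). Let $G$ be a graph of order $n$ with fractional matching number $\nu^{*}(G)=s$ and minimum degree $\delta(G)=\delta$. If $2s$ is even, then $$N(K_{\ell},G)\leq \max\left\{g_{\ell}(n,s,\delta),\,g_{\ell}(n,s,s)\right\}.$$ If $2s$ is odd, then $$N(K_{\ell},G)\leq \max\left\{g_{\ell}(n,s,\delta),\,g_{\ell}\left(n,s,s-\tfrac{3}{2}\right)\right\}.$$
   Context: All graphs are finite and simple. A fractional matching of a graph $G$ is a function $f:E(G)\to[0,1]$ such that $\sum_{e\ni x}f(e)\le 1$ for every vertex $x$; the fractional matching number $\nu^{*}(G)$ is the maximum of $\sum_{e\in E(G)}f(e)$ over all fractional matchings $f$. For graphs $H,G$, $N(H,G)$ denotes the number of (not necessarily induced) subgraphs of $G$ isomorphic to $H$. $K_m$ is the complete graph on $m$ vertices, $\overline{K_m}$ the edgeless graph on $m$ vertices, $H+F$ the disjoint union, and $H\vee F$ the join (disjoint union plus all edges between $V(H)$ and $V(F)$). For an integer $t$ with $\delta\le t\le s$, $G(n,s,t)$ denotes the graph obtained from $K_{t}\vee\left(K_{2s-2t}+\overline{K_{n+t-2s}}\right)$ by deleting $t-\delta$ edges incident to one common vertex $u$ of $\overline{K_{n+t-2s}}$ (so $u$ has degree $\delta$), and $g_{\ell}(n,s,t)=N(K_\ell,G(n,s,t))$.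
   Formalization: Fractional matchings take rational rather than real values in [0,1], so the fractional matching number is the maximum over rational fractional matchings; it equals the real maximum because the linear program has a rational optimal vertex. -}

module Defs where

open import Data.Bool using (Bool; true; false; if_then_else_; _∧_; _∨_; not)
open import Data.Nat using (ℕ; zero; suc; _+_; _∸_; _<ᵇ_; _≡ᵇ_; _⊓_; _⊔_; _≤_)
open import Data.Nat.Properties using (⊓-comm; ⊔-comm)
open import Data.Fin using (Fin; toℕ)
open import Data.Fin.Subset using (Subset; ∣_∣)
open import Data.Vec using (Vec; []; _∷_; lookup)
open import Data.List using (List; []; _∷_; map; length; allFin; filterᵇ; concatMap; foldr)
open import Data.Bool.ListAction using (and)
open import Data.Nat.ListAction using (sum)
open import Data.List.Membership.Propositional using (_∈_)
open import Data.Product using (_×_; _,_; Σ; ∃)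
open import Data.Rational using (ℚ; 0ℚ; 1ℚ) renaming (_+_ to _+ℚ_; _≤_ to _≤ℚ_)
open import Relation.Binary.PropositionalEquality using (_≡_; refl; cong₂)

record Graph (n : ℕ) : Set where
  field
    adj    : Fin n → Fin n → Bool
    sym    : ∀ i j → adj i j ≡ adj j i
    irrefl : ∀ i → adj i i ≡ false
open Graph public

deg : ∀ {n} → Graph n → Fin n → ℕ
deg {n} G x = sum (map (λ j → if adj G x j then 1 else 0) (allFin n))

MinDegree : ∀ {n} → Graph n → ℕ → Set
MinDegree {n} G d = (∀ x → d ≤ deg G x) × ∃ λ x → deg G x ≡ d

edges : ∀ {n} → Graph n → List (Fin n × Fin n)
edges {n} G =
  concatMap (λ i → concatMap (λ j →
      if (toℕ i <ᵇ toℕ j) ∧ adj G i j then (i , j) ∷ [] else [])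
    (allFin n)) (allFin n)

incident : ∀ {n} → Fin n → Fin n × Fin n → Bool
incident x (i , j) = (toℕ i ≡ᵇ toℕ x) ∨ (toℕ j ≡ᵇ toℕ x)

sumℚ : List ℚ → ℚ
sumℚ = foldr _+ℚ_ 0ℚ

-- A fractional matching: a weight f(e) ∈ [0,1] on every edge e, with
-- the total weight at every vertex at most 1 (values of f off the edge
-- set are irrelevant).
FracMatching : ∀ {n} → Graph n → (Fin n × Fin n → ℚ) → Set
FracMatching G f =
  (∀ e → e ∈ edges G → (0ℚ ≤ℚ f e) × (f e ≤ℚ 1ℚ)) ×
  (∀ x → sumℚ (map f (filterᵇ (incident x) (edges G))) ≤ℚ 1ℚ)

fmValue : ∀ {n} → Graph n → (Fin n × Fin n → ℚ) → ℚ
fmValue G f = sumℚ (map f (edges G))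

FracMatchingNumber : ∀ {n} → Graph n → ℚ → Set
FracMatchingNumber G r =
  (Σ (_ → ℚ) λ f → FracMatching G f × fmValue G f ≡ r) ×
  (∀ f → FracMatching G f → fmValue G f ≤ℚ r)

allSubsets : (n : ℕ) → List (Subset n)
allSubsets zero    = [] ∷ []
allSubsets (suc n) = map (true ∷_) (allSubsets n) Data.List.++ map (false ∷_) (allSubsets n)
  where import Data.List

allB : ∀ {A : Set} → (A → Bool) → List A → Bool
allB p xs = and (map p xs)

isClique : ∀ {n} → Graph n → Subset n → Bool
isClique {n} G S =
  allB (λ i → allB (λ j →
        not (lookup S i ∧ lookup S j ∧ not (toℕ i ≡ᵇ toℕ j)) ∨ adj G i j)
      (allFin n)) (allFin n)

NK : ℕ → ∀ {n} → Graph n → ℕ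
NK ℓ {n} G = length (filterᵇ (λ S → (∣ S ∣ ≡ᵇ ℓ) ∧ isClique G S) (allSubsets n))

-- The extremal graph G(n,s,t), with k = 2s.
-- Vertices 0..t-1 : the K_t;  t..k-t-1 : the K_{2s-2t};
-- k-t..n-1 : the independent set, u = n-1.  u is joined to the
-- vertices 0..δ-1 of K_t only (i.e. the t-δ edges from u to the
-- vertices δ..t-1 are deleted).  Intended for δ ≤ t ≤ k/2, n ≥ k+1.

-- edge indicator for a pair a < b
extE : (n k δ t : ℕ) → ℕ → ℕ → Bool
extE n k δ t a b =
  if b <ᵇ t then true
  else if a <ᵇ t then (if b ≡ᵇ (n ∸ 1) then a <ᵇ δ else true)
  else (b <ᵇ (k ∸ t))

≡ᵇ-sym : ∀ a b → (a ≡ᵇ b) ≡ (b ≡ᵇ a)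
≡ᵇ-sym zero zero = refl
≡ᵇ-sym zero (suc b) = refl
≡ᵇ-sym (suc a) zero = refl
≡ᵇ-sym (suc a) (suc b) = ≡ᵇ-sym a b

≡ᵇ-refl : ∀ a → (a ≡ᵇ a) ≡ true
≡ᵇ-refl zero = refl
≡ᵇ-refl (suc a) = ≡ᵇ-refl a

extAdj : (n k δ t : ℕ) → ℕ → ℕ → Bool
extAdj n k δ t a b = not (a ≡ᵇ b) ∧ extE n k δ t (a ⊓ b) (a ⊔ b)

extAdj-sym : ∀ n k δ t a b → extAdj n k δ t a b ≡ extAdj n k δ t b a
extAdj-sym n k δ t a b =
  cong₂ (λ x y → not x ∧ y) (≡ᵇ-sym a b)
        (cong₂ (extE n k δ t) (⊓-comm a b) (⊔-comm a b))

extAdj-irrefl : ∀ n k δ t a → extAdj n k δ t a a ≡ false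
extAdj-irrefl n k δ t a rewrite ≡ᵇ-refl a = refl

Gext : (n k δ t : ℕ) → Graph n
Gext n k δ t = record
  { adj    = λ i j → extAdj n k δ t (toℕ i) (toℕ j)
  ; sym    = λ i j → extAdj-sym n k δ t (toℕ i) (toℕ j)
  ; irrefl = λ i → extAdj-irrefl n k δ t (toℕ i)
  }

-- g_ℓ(n,s,t) with k = 2s (δ is the ambient minimum degree)
g : (ℓ n k δ t : ℕ) → ℕ
g ℓ n k δ t = NK ℓ (Gext n k δ t)

{-# OPTIONS --safe #-}
module Submission where

-- Let G' be the bipartite double cover of G.  A matching of G', halved, is a
-- fractional matching of G, so it has at most k = 2ν* edges, and König's theorem
-- gives a cover (A, B) of G' with |A| + |B| ≤ k.  Put V₁ = A ∩ B, t = |V₁| and let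
-- V₀ be the complement of A ∪ B.  Then V₀ is independent, all its neighbours lie in
-- V₁, and |V₀| ≥ n − k + t; in particular δ ≤ t ≤ k/2.  For odd k = 2m + 1, t = m
-- would make V₁ a vertex cover of size m < ν*, so t ≤ m − 1.
-- Deleting first a vertex of degree δ and then n − k − 1 + t vertices of V₀, each
-- with at most t neighbours, leaves k − t vertices, so G has at most
--   C(k − t, ℓ) + (n − k − 1 + t) C(t, ℓ − 1) + C(δ, ℓ − 1)
-- cliques of size ℓ.  This is g_ℓ(n, k/2, t), and it is convex in t.

open import Defs
open import Algebra.Bundles using (CommutativeMonoid)
open import Data.Bool using (Bool; true; false; if_then_else_; T; T?; _∧_; _∨_; not)
open import Data.Bool.Properties using (T-≡) renaming (_≟_ to _≟ᵇ_)
open import Data.Empty using (⊥-elim)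
open import Data.Fin as Fin using (Fin; zero; suc; toℕ; fromℕ<)
open import Data.Fin.Properties using (any?; toℕ-injective; toℕ-fromℕ<)
open import Data.Fin.Subset using (Subset; ∣_∣) renaming (⊥ to ∅)
open import Data.Fin.Subset.Properties using (∣⊥∣≡0)
import Data.Integer as ℤ
import Data.Integer.Properties as ℤ
import Data.Integer.Tactic.RingSolver as ℤSolver
open import Data.List as List using (List; []; _∷_; allFin; filterᵇ; length)
open import Data.List.Membership.Propositional using (_∈_)
open import Data.List.Membership.Propositional.Properties using (∈-filter⁻; ∈-filter⁺; ∈-allFin; ∈-concatMap⁻)
open import Data.List.Properties using (map-++)
open import Data.List.Relation.Unary.Any using (here; there; satisfied)
open import Data.Nat using (ℕ; zero; suc; _+_; _*_; _∸_; _≤_; _<_; _≤′_; ≤′-refl; ≤′-step; z≤n; s≤s; s≤s⁻¹; _⊔_; _≡ᵇ_; _<ᵇ_; _≤?_)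
open import Data.Nat.Combinatorics using (_C_; nCk+nC[k+1]≡[n+1]C[k+1])
import Data.Nat.ListAction as ListAction
open import Data.Nat.ListAction.Properties using (sum-++)
open import Data.Nat.Properties
open import Data.Nat.Tactic.RingSolver using (solve-∀)
open import Data.Product using (_×_; _,_; ∃; proj₁; proj₂)
open import Data.Rational as ℚ using (ℚ; 0ℚ; 1ℚ; _/_)
import Data.Rational.Properties as ℚ
open import Data.Rational.Unnormalised as ℚᵘ using (mkℚᵘ; *≤*; *≡*)
import Data.Rational.Unnormalised.Properties as ℚᵘ
open import Data.Sum using (_⊎_; inj₁; inj₂; swap)
open import Data.Vec using ([]; _∷_; lookup; _[_]≔_)
open import Data.Vec.Properties using (lookup∘update; lookup∘update′; lookup-replicate)
open import Function using (_∘_; id; flip; case_of_; Equivalence)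
open import Relation.Binary using (tri<; tri≈; tri>)
open import Relation.Binary.PropositionalEquality as ≡ using (_≡_; _≢_; refl; cong; cong₂; trans; subst)
open import Relation.Nullary using (¬_; ¬?; yes; no; contradiction; _×-dec_)
open import Relation.Nullary.Decidable using (decidable-stable)

open import Algebra.Properties.CommutativeSemigroup +-commutativeSemigroup using (interchange)
open import Algebra.Properties.CommutativeSemigroup (CommutativeMonoid.commutativeSemigroup ℚ.+-0-commutativeMonoid) using (x∙yz≈y∙xz)
open import Algebra.Properties.CommutativeMonoid.Sum +-0-commutativeMonoid using (sum; sum-cong-≗; ∑-distrib-+; ∑-comm; sum-replicate-zero)

-- Booleans, finite sums and vertex sets

∧-elim : ∀ {a b} → a ∧ b ≡ true → a ≡ true × b ≡ true
∧-elim {true} {true} _ = refl , refl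

∧-intro : ∀ {a b} → a ≡ true → b ≡ true → a ∧ b ≡ true
∧-intro refl refl = refl

∨-elim : ∀ {a b} → a ∨ b ≡ true → a ≡ true ⊎ b ≡ true
∨-elim {true} _ = inj₁ refl
∨-elim {false} e = inj₂ e

∨-introˡ : ∀ {a b} → a ≡ true → a ∨ b ≡ true
∨-introˡ refl = refl

∨-introʳ : ∀ {a b} → b ≡ true → a ∨ b ≡ true
∨-introʳ {true} refl = refl
∨-introʳ {false} refl = refl

not-elim : ∀ {a} → not a ≡ true → a ≢ true
not-elim {false} _ ()

not-intro : ∀ {a} → a ≢ true → not a ≡ true
not-intro {true} h = ⊥-elim (h refl)
not-intro {false} _ = refl

≡ᵇ-sound : ∀ a b → (a ≡ᵇ b) ≡ true → a ≡ b
≡ᵇ-sound a b e = ≡ᵇ⇒≡ a b (subst T (≡.sym e) _)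

⟦_⟧ : Bool → ℕ
⟦ b ⟧ = if b then 1 else 0

⟦⟧-mono : ∀ {a b} → (a ≡ true → b ≡ true) → ⟦ a ⟧ ≤ ⟦ b ⟧
⟦⟧-mono {false} _ = z≤n
⟦⟧-mono {true} h rewrite h refl = ≤-refl

⟦⟧≤1 : ∀ b → ⟦ b ⟧ ≤ 1
⟦⟧≤1 true = ≤-refl
⟦⟧≤1 false = z≤n

sum-mono : ∀ {n} {f g : Fin n → ℕ} → (∀ i → f i ≤ g i) → sum f ≤ sum g
sum-mono {zero} h = z≤n
sum-mono {suc n} h = +-mono-≤ (h zero) (sum-mono (h ∘ suc))

sum-mono-< : ∀ {n} {f g : Fin n → ℕ} → (∀ i → f i ≤ g i) → ∀ x → f x < g x → sum f < sum g
sum-mono-< h zero lt = +-mono-<-≤ lt (sum-mono (h ∘ suc))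
sum-mono-< h (suc x) lt = +-mono-≤-< (h zero) (sum-mono-< (h ∘ suc) x lt)

sum-point : ∀ {n} (f : Fin n → ℕ) x → sum (λ i → if toℕ i ≡ᵇ toℕ x then f i else 0) ≡ f x
sum-point {suc n} f zero = trans (cong (f zero +_) (sum-replicate-zero n)) (+-identityʳ _)
sum-point f (suc x) = sum-point (f ∘ suc) x

-- Predicates instead of `Subset`s: `adj G v` is then itself the neighbourhood of `v`, and a row of
-- a relation is a set. `Subset` is kept for the cliques being counted.
VSet : ℕ → Set
VSet n = Fin n → Bool

# : ∀ {n} → VSet n → ℕ
# A = sum (λ i → ⟦ A i ⟧)

infix 4 _⊆_
_⊆_ : ∀ {n} → VSet n → VSet n → Set
A ⊆ B = ∀ i → A i ≡ true → B i ≡ true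

full : ∀ {n} → VSet n
full _ = true

infixl 6 _−_
_−_ : ∀ {n} → VSet n → Fin n → VSet n
(A − v) i = A i ∧ not (toℕ i ≡ᵇ toℕ v)

infixl 7 _∩_
_∩_ : ∀ {n} → VSet n → VSet n → VSet n
(A ∩ B) i = A i ∧ B i

infixl 7 _∪_
_∪_ : ∀ {n} → VSet n → VSet n → VSet n
(A ∪ B) i = A i ∨ B i

∁ : ∀ {n} → VSet n → VSet n
∁ A i = not (A i)

−-intro : ∀ {n} {A : VSet n} {v i} → A i ≡ true → i ≢ v → (A − v) i ≡ true
−-intro p ne = ∧-intro p (not-intro (ne ∘ toℕ-injective ∘ ≡ᵇ-sound _ _))

−-elim : ∀ {n} {A : VSet n} {v i} → (A − v) i ≡ true → A i ≡ true × i ≢ v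
−-elim {v = v} p with a , b ← ∧-elim p = a , λ { refl → not-elim b (≡ᵇ-refl (toℕ v)) }

#-mono : ∀ {n} {A B : VSet n} → A ⊆ B → # A ≤ # B
#-mono h = sum-mono (λ i → ⟦⟧-mono (h i))

#-full : ∀ n → # (full {n}) ≡ n
#-full zero = refl
#-full (suc n) = cong suc (#-full n)

#-+ : ∀ {n} {A B C D : VSet n} → (∀ i → ⟦ A i ⟧ + ⟦ B i ⟧ ≡ ⟦ C i ⟧ + ⟦ D i ⟧) → # A + # B ≡ # C + # D
#-+ {A = A} {B} {C} {D} h = trans (≡.sym (∑-distrib-+ (⟦_⟧ ∘ A) (⟦_⟧ ∘ B))) (trans (sum-cong-≗ h) (∑-distrib-+ (⟦_⟧ ∘ C) (⟦_⟧ ∘ D)))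

#-∩-∪ : ∀ {n} (A B : VSet n) → # (A ∩ B) + # (A ∪ B) ≡ # A + # B
#-∩-∪ A B = #-+ {A = A ∩ B} {A ∪ B} {A} {B} λ i → lem (A i) (B i)
  where
  lem : ∀ a b → ⟦ a ∧ b ⟧ + ⟦ a ∨ b ⟧ ≡ ⟦ a ⟧ + ⟦ b ⟧
  lem true true = refl
  lem true false = refl
  lem false true = refl
  lem false false = refl

#-∁ : ∀ {n} (A : VSet n) → # A + # (∁ A) ≡ n
#-∁ {n} A = trans (≡.sym (∑-distrib-+ (⟦_⟧ ∘ A) (⟦_⟧ ∘ ∁ A))) (trans (sum-cong-≗ (λ i → lem (A i))) (#-full n))
  where
  lem : ∀ a → ⟦ a ⟧ + ⟦ not a ⟧ ≡ 1
  lem true = refl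
  lem false = refl

#-− : ∀ {n} (A : VSet n) v → # A ≡ # (A − v) + ⟦ A v ⟧
#-− A v = trans (sum-cong-≗ λ i → lem (A i) (toℕ i ≡ᵇ toℕ v))
  (trans (∑-distrib-+ (⟦_⟧ ∘ (A − v)) _) (cong (# (A − v) +_) (sum-point (⟦_⟧ ∘ A) v)))
  where
  lem : ∀ a b → ⟦ a ⟧ ≡ ⟦ a ∧ not b ⟧ + (if b then ⟦ a ⟧ else 0)
  lem true true = refl
  lem true false = refl
  lem false true = refl
  lem false false = refl

#-−-∈ : ∀ {n} (A : VSet n) v → A v ≡ true → # A ≡ suc (# (A − v))
#-−-∈ A v p = trans (#-− A v) (trans (cong (λ b → # (A − v) + ⟦ b ⟧) p) (+-comm _ 1))

∈⇒0<# : ∀ {n} (A : VSet n) v → A v ≡ true → 0 < # A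
∈⇒0<# A v p rewrite #-−-∈ A v p = s≤s z≤n

0<#⇒∈ : ∀ {n} (A : VSet n) → 0 < # A → ∃ λ v → A v ≡ true
0<#⇒∈ {suc n} A h with A zero in eq
... | true = zero , eq
... | false with v , p ← 0<#⇒∈ (A ∘ suc) h = suc v , p

atMostOne⇒#≤1 : ∀ {n} (A : VSet n) → (∀ i j → A i ≡ true → A j ≡ true → i ≡ j) → # A ≤ 1
atMostOne⇒#≤1 A uniq with # A in eq
... | zero = z≤n
... | suc zero = ≤-refl
... | suc (suc m) with v , p ← 0<#⇒∈ A (subst (0 <_) (≡.sym eq) (s≤s z≤n))
  with w , q ← 0<#⇒∈ (A − v) (subst (0 <_) (suc-injective (trans (≡.sym eq) (#-−-∈ A v p))) (s≤s z≤n))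
  with q′ , w≢v ← −-elim {A = A} q = contradiction (uniq w v q′ p) w≢v

-- Counting cliques

-- Follows the recursion of `allSubsets`, so that counts can be compared by induction on `n` without
-- lists.
count : ∀ n → (Subset n → Bool) → ℕ
count zero P = ⟦ P [] ⟧
count (suc n) P = count n (λ S → P (true ∷ S)) + count n (λ S → P (false ∷ S))

length-filterᵇ-map : ∀ {A B : Set} (P : B → Bool) (f : A → B) xs →
  length (filterᵇ P (List.map f xs)) ≡ length (filterᵇ (P ∘ f) xs)
length-filterᵇ-map P f [] = refl
length-filterᵇ-map P f (x ∷ xs) with P (f x)
... | true = cong suc (length-filterᵇ-map P f xs)
... | false = length-filterᵇ-map P f xs

length-filterᵇ-++ : ∀ {A : Set} (P : A → Bool) xs ys →
  length (filterᵇ P (xs List.++ ys)) ≡ length (filterᵇ P xs) + length (filterᵇ P ys)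
length-filterᵇ-++ P [] ys = refl
length-filterᵇ-++ P (x ∷ xs) ys with P x
... | true = cong suc (length-filterᵇ-++ P xs ys)
... | false = length-filterᵇ-++ P xs ys

count-allSubsets : ∀ n P → length (filterᵇ P (allSubsets n)) ≡ count n P
count-allSubsets zero P with P []
... | true = refl
... | false = refl
count-allSubsets (suc n) P =
  trans (length-filterᵇ-++ P (List.map (true ∷_) (allSubsets n)) _)
    (cong₂ _+_ (trans (length-filterᵇ-map P (true ∷_) (allSubsets n)) (count-allSubsets n _))
               (trans (length-filterᵇ-map P (false ∷_) (allSubsets n)) (count-allSubsets n _)))

count-mono : ∀ n {P Q} → (∀ S → P S ≡ true → Q S ≡ true) → count n P ≤ count n Q
count-mono zero h = ⟦⟧-mono (h [])
count-mono (suc n) h = +-mono-≤ (count-mono n (h ∘ (true ∷_))) (count-mono n (h ∘ (false ∷_)))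

count-false : ∀ n → count n (λ _ → false) ≡ 0
count-false zero = refl
count-false (suc n) = cong₂ _+_ (count-false n) (count-false n)

∈⇒0<count : ∀ {n} (P : Subset n → Bool) S → P S ≡ true → 0 < count n P
∈⇒0<count P [] p rewrite p = ≤-refl
∈⇒0<count P (true ∷ S) p = ≤-trans (∈⇒0<count _ S p) (m≤m+n _ _)
∈⇒0<count P (false ∷ S) p = ≤-trans (∈⇒0<count _ S p) (m≤n+m _ _)

-- Deleting `v` is a bijection from the subsets containing `v` to those avoiding it, so both classes
-- are counted over subsets without `v`.
count-split : ∀ {n} (P : Subset n → Bool) v → count n P ≡
  count n (λ S → not (lookup S v) ∧ P S) + count n (λ S → not (lookup S v) ∧ P (S [ v ]≔ true))
count-split {suc n} P zero rewrite count-false n = +-comm (count n (λ S → P (true ∷ S))) _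
count-split {suc n} P (suc v) = trans
  (cong₂ _+_ (count-split (λ S → P (true ∷ S)) v) (count-split (λ S → P (false ∷ S)) v))
  (interchange (count n (λ S → not (lookup S v) ∧ P (true ∷ S))) _ _ _)

count-size0 : ∀ n → count n (λ S → ∣ S ∣ ≡ᵇ 0) ≤ 1
count-size0 zero = ≤-refl
count-size0 (suc n) rewrite count-false n = count-size0 n

∣S∣>0⇒∈ : ∀ {n} (S : Subset n) → 0 < ∣ S ∣ → ∃ λ i → lookup S i ≡ true
∣S∣>0⇒∈ (true ∷ S) _ = zero , refl
∣S∣>0⇒∈ (false ∷ S) h with i , p ← ∣S∣>0⇒∈ S h = suc i , p

∣insert∣ : ∀ {n} (S : Subset n) v → lookup S v ≢ true → ∣ S [ v ]≔ true ∣ ≡ suc ∣ S ∣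
∣insert∣ (true ∷ S) zero h = ⊥-elim (h refl)
∣insert∣ (false ∷ S) zero h = refl
∣insert∣ (true ∷ S) (suc v) h = cong suc (∣insert∣ S v h)
∣insert∣ (false ∷ S) (suc v) h = ∣insert∣ S v h

allB-intro : ∀ {n} {A : Set} (p : A → Bool) (f : Fin n → A) → (∀ i → p (f i) ≡ true) → allB p (List.tabulate f) ≡ true
allB-intro {zero} p f h = refl
allB-intro {suc n} p f h = ∧-intro (h zero) (allB-intro p (f ∘ suc) (h ∘ suc))

allB-elim : ∀ {n} {A : Set} (p : A → Bool) (f : Fin n → A) → allB p (List.tabulate f) ≡ true → ∀ i → p (f i) ≡ true
allB-elim p f e zero = proj₁ (∧-elim e)
allB-elim p f e (suc i) = allB-elim p (f ∘ suc) (proj₂ (∧-elim e)) i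

PairwiseAdjacent : ∀ {n} → Graph n → VSet n → Set
PairwiseAdjacent G W = ∀ i j → W i ≡ true → W j ≡ true → i ≢ j → adj G i j ≡ true

isClique-intro : ∀ {n} (G : Graph n) S → PairwiseAdjacent G (lookup S) → isClique G S ≡ true
isClique-intro G S h = allB-intro _ id λ i → allB-intro _ id λ j → lem i j
  where
  lem : ∀ i j → not (lookup S i ∧ lookup S j ∧ not (toℕ i ≡ᵇ toℕ j)) ∨ adj G i j ≡ true
  lem i j with lookup S i ∧ lookup S j ∧ not (toℕ i ≡ᵇ toℕ j) in eq
  ... | false = refl
  ... | true with a , b ← ∧-elim {lookup S i} eq with c , d ← ∧-elim {lookup S j} b =
    h i j a c λ { refl → not-elim d (≡ᵇ-refl (toℕ i)) }

isClique-elim : ∀ {n} (G : Graph n) S → isClique G S ≡ true → PairwiseAdjacent G (lookup S)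
isClique-elim G S e i j p q i≢j with ∨-elim (allB-elim _ id (allB-elim _ id e i) j)
... | inj₂ a = a
... | inj₁ a = ⊥-elim (not-elim a (∧-intro p (∧-intro q (not-intro (i≢j ∘ toℕ-injective ∘ ≡ᵇ-sound _ _)))))

record Clique {n} (G : Graph n) (ℓ : ℕ) (W : VSet n) (S : Subset n) : Set where
  constructor clique
  field
    size     : ∣ S ∣ ≡ ℓ
    pairwise : PairwiseAdjacent G (lookup S)
    inside   : lookup S ⊆ W

isCliqueIn : ∀ {n} → Graph n → ℕ → VSet n → Subset n → Bool
isCliqueIn {n} G ℓ W S = ((∣ S ∣ ≡ᵇ ℓ) ∧ isClique G S) ∧ allB (λ i → not (lookup S i) ∨ W i) (allFin n)

isCliqueIn-intro : ∀ {n} (G : Graph n) ℓ W S → Clique G ℓ W S → isCliqueIn G ℓ W S ≡ true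
isCliqueIn-intro G _ W S (clique refl p w) =
  ∧-intro (∧-intro (≡ᵇ-refl ∣ S ∣) (isClique-intro G S p)) (allB-intro _ id λ i → lem i)
  where
  lem : ∀ i → not (lookup S i) ∨ W i ≡ true
  lem i with lookup S i in eq
  ... | true = w i eq
  ... | false = refl

isCliqueIn-elim : ∀ {n} (G : Graph n) ℓ W S → isCliqueIn G ℓ W S ≡ true → Clique G ℓ W S
isCliqueIn-elim G ℓ W S e with a , b ← ∧-elim e with c , d ← ∧-elim a =
  clique (≡ᵇ-sound _ _ c) (isClique-elim G S d) lem
  where
  lem : lookup S ⊆ W
  lem i p with ∨-elim (allB-elim _ id b i)
  ... | inj₁ q = ⊥-elim (not-elim q p)
  ... | inj₂ q = q

cliques : ∀ {n} → Graph n → ℕ → VSet n → ℕ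
cliques {n} G ℓ W = count n (isCliqueIn G ℓ W)

cliques-mono : ∀ {n} (G : Graph n) ℓ {W W′} → W ⊆ W′ → cliques G ℓ W ≤ cliques G ℓ W′
cliques-mono {n} G ℓ {W} {W′} h = count-mono n λ S e → let clique s p w = isCliqueIn-elim G ℓ W S e in
  isCliqueIn-intro G ℓ W′ S (clique s p (λ i → h i ∘ w i))

NK≡cliques : ∀ {n} (G : Graph n) ℓ → NK ℓ G ≡ cliques G ℓ full
NK≡cliques {n} G ℓ = trans (count-allSubsets n _) (≤-antisym
  (count-mono n λ S e → ∧-intro e (allB-intro _ id λ i → ∨-introʳ {not (lookup S i)} refl))
  (count-mono n λ S e → proj₁ (∧-elim e)))

-- With `restrict`, this gives the correspondence between the cliques through `v` and the cliques,
-- one vertex smaller, in the neighbourhood of `v`.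
extend : ∀ {n} (G : Graph n) {ℓ W v S} → W v ≡ true → lookup S v ≢ true →
  Clique G ℓ (W ∩ adj G v) S → Clique G (suc ℓ) W (S [ v ]≔ true)
extend {n} G {W = W} {v} {S} v∈W v∉S (clique s p w) =
  clique (trans (∣insert∣ S v v∉S) (cong suc s)) pairs (λ i q → ins i q)
  where
  old : ∀ i → i ≢ v → lookup (S [ v ]≔ true) i ≡ true → lookup S i ≡ true
  old i ne q = trans (≡.sym (lookup∘update′ ne S true)) q
  ins : lookup (S [ v ]≔ true) ⊆ W
  ins i q with i Fin.≟ v
  ... | yes refl = v∈W
  ... | no ne = proj₁ (∧-elim (w i (old i ne q)))
  pairs : PairwiseAdjacent G (lookup (S [ v ]≔ true))
  pairs i j q r ne with i Fin.≟ v | j Fin.≟ v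
  ... | yes refl | yes refl = ⊥-elim (ne refl)
  ... | yes refl | no j≢v = proj₂ (∧-elim {W j} (w j (old j j≢v r)))
  ... | no i≢v | yes refl = trans (Graph.sym G i v) (proj₂ (∧-elim {W i} (w i (old i i≢v q))))
  ... | no i≢v | no j≢v = p i j (old i i≢v q) (old j j≢v r) ne

restrict : ∀ {n} (G : Graph n) {ℓ W v S} → lookup S v ≢ true →
  Clique G (suc ℓ) W (S [ v ]≔ true) → Clique G ℓ (W ∩ adj G v) S
restrict {n} G {W = W} {v} {S} v∉S (clique s p w) =
  clique (suc-injective (trans (≡.sym (∣insert∣ S v v∉S)) s))
    (λ i j q r → p i j (new i q) (new j r))
    (λ i q → ∧-intro (w i (new i q)) (p v i (lookup∘update v S true) (new i q) λ { refl → v∉S q }))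
  where
  new : ∀ i → lookup S i ≡ true → lookup (S [ v ]≔ true) i ≡ true
  new i q with i Fin.≟ v
  ... | yes refl = lookup∘update v S true
  ... | no ne = trans (lookup∘update′ ne S true) q

-- A clique either avoids `v`, or it loses `v` and becomes a clique among the neighbours of `v`. For
-- `v` in `W` the reverse inequality follows below.
cliques-step-≤ : ∀ {n} (G : Graph n) ℓ W v →
  cliques G (suc ℓ) W ≤ cliques G (suc ℓ) (W − v) + cliques G ℓ (W ∩ adj G v)
cliques-step-≤ {n} G ℓ W v = ≤-trans (≤-reflexive (count-split _ v)) (+-mono-≤
  (count-mono n λ S e → let a , b = ∧-elim {not (lookup S v)} e ; clique s p w = isCliqueIn-elim G (suc ℓ) W S b in
    isCliqueIn-intro G (suc ℓ) (W − v) S (clique s p λ i q → −-intro {A = W} (w i q) λ { refl → not-elim a q }))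
  (count-mono n λ S e → let a , b = ∧-elim {not (lookup S v)} e in
    isCliqueIn-intro G ℓ (W ∩ adj G v) S
      (restrict G (not-elim a) (isCliqueIn-elim G (suc ℓ) W (S [ v ]≔ true) b))))

cliques-step-≥ : ∀ {n} (G : Graph n) ℓ W v → W v ≡ true →
  cliques G (suc ℓ) (W − v) + cliques G ℓ (W ∩ adj G v) ≤ cliques G (suc ℓ) W
cliques-step-≥ {n} G ℓ W v v∈W = ≤-trans (+-mono-≤
  (count-mono n λ S e → let clique s p w = isCliqueIn-elim G (suc ℓ) (W − v) S e in ∧-intro
    (not-intro λ q → proj₂ (−-elim {A = W} (w v q)) refl)
    (isCliqueIn-intro G (suc ℓ) W S (clique s p λ i q → proj₁ (−-elim {A = W} (w i q)))))
  (count-mono n λ S e → let c = isCliqueIn-elim G ℓ (W ∩ adj G v) S e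
                            v∉S = λ q → v∉N (proj₂ (∧-elim {W v} (Clique.inside c v q))) in
    ∧-intro (not-intro v∉S) (isCliqueIn-intro G (suc ℓ) W (S [ v ]≔ true) (extend G v∈W v∉S c))))
  (≤-reflexive (≡.sym (count-split _ v)))
  where
  v∉N : adj G v v ≢ true
  v∉N e = case trans (≡.sym e) (irrefl G v) of λ ()

-- Enlarging the neighbourhood of `v` in `W` to `W − v` turns the recursion of `cliques-step-≤` into
-- Pascal's rule.
cliques≤C : ∀ {n} (G : Graph n) ℓ W → cliques G ℓ W ≤ # W C ℓ
cliques≤C {n} G ℓ W = go ℓ W (# W) refl
  where
  -- The size of `W` is an argument of its own, which makes the recursion structural.
  go : ∀ ℓ W w → # W ≡ w → cliques G ℓ W ≤ w C ℓ
  go zero W w _ = ≤-trans (count-mono n λ S e → proj₁ (∧-elim {∣ S ∣ ≡ᵇ 0} (proj₁ (∧-elim e)))) (count-size0 n)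
  go (suc ℓ) W zero eq = ≤-trans (count-mono n λ S e → ⊥-elim (empty S e)) (≤-reflexive (count-false n))
    where
    empty : ∀ S → isCliqueIn G (suc ℓ) W S ≢ true
    empty S e with clique s p w ← isCliqueIn-elim G (suc ℓ) W S e
      with i , q ← ∣S∣>0⇒∈ S (subst (0 <_) (≡.sym s) (s≤s z≤n)) =
      case subst (0 <_) eq (∈⇒0<# W i (w i q)) of λ ()
  go (suc ℓ) W (suc w) eq with v , p ← 0<#⇒∈ W (subst (0 <_) (≡.sym eq) (s≤s z≤n)) = begin
    cliques G (suc ℓ) W                                      ≤⟨ cliques-step-≤ G ℓ W v ⟩
    cliques G (suc ℓ) (W − v) + cliques G ℓ (W ∩ adj G v)    ≤⟨ +-monoʳ-≤ _ (cliques-mono G ℓ N⊆) ⟩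
    cliques G (suc ℓ) (W − v) + cliques G ℓ (W − v)          ≤⟨ +-mono-≤ (go (suc ℓ) (W − v) w eq′) (go ℓ (W − v) w eq′) ⟩
    w C suc ℓ + w C ℓ                                        ≡⟨ +-comm (w C suc ℓ) _ ⟩
    w C ℓ + w C suc ℓ                                        ≡⟨ nCk+nC[k+1]≡[n+1]C[k+1] w ℓ ⟩
    suc w C suc ℓ                                            ∎
    where
    open ≤-Reasoning
    eq′ : # (W − v) ≡ w
    eq′ = suc-injective (trans (≡.sym (#-−-∈ W v p)) eq)
    N⊆ : W ∩ adj G v ⊆ W − v
    N⊆ i e with a , b ← ∧-elim e = −-intro {A = W} a λ { refl → case trans (≡.sym b) (irrefl G v) of λ () }

-- The same recursion run backwards: in a clique `W`, the neighbourhood of `v` contains all of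
-- `W − v`.
C≤cliques : ∀ {n} (G : Graph n) ℓ W → PairwiseAdjacent G W → # W C ℓ ≤ cliques G ℓ W
C≤cliques {n} G ℓ W adjW = go ℓ W (# W) refl adjW
  where
  go : ∀ ℓ W w → # W ≡ w → PairwiseAdjacent G W → w C ℓ ≤ cliques G ℓ W
  go zero W w _ _ = ∈⇒0<count (isCliqueIn G zero W) ∅ (isCliqueIn-intro G zero W ∅ (clique (∣⊥∣≡0 n)
    (λ i _ p → ⊥-elim (∉∅ i p)) (λ i p → ⊥-elim (∉∅ i p))))
    where
    ∉∅ : ∀ i → lookup ∅ i ≢ true
    ∉∅ i p = case trans (≡.sym p) (lookup-replicate i false) of λ ()
  go (suc ℓ) W zero _ _ = z≤n
  go (suc ℓ) W (suc w) eq h with v , p ← 0<#⇒∈ W (subst (0 <_) (≡.sym eq) (s≤s z≤n)) = begin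
    suc w C suc ℓ                                            ≡⟨ nCk+nC[k+1]≡[n+1]C[k+1] w ℓ ⟨
    w C ℓ + w C suc ℓ                                        ≡⟨ +-comm (w C ℓ) _ ⟩
    w C suc ℓ + w C ℓ                                        ≤⟨ +-mono-≤ (go (suc ℓ) (W − v) w eq′ h′) (go ℓ (W − v) w eq′ h′) ⟩
    cliques G (suc ℓ) (W − v) + cliques G ℓ (W − v)          ≤⟨ +-monoʳ-≤ _ (cliques-mono G ℓ ⊆N) ⟩
    cliques G (suc ℓ) (W − v) + cliques G ℓ (W ∩ adj G v)    ≤⟨ cliques-step-≥ G ℓ W v p ⟩
    cliques G (suc ℓ) W                                      ∎
    where
    open ≤-Reasoning
    eq′ : # (W − v) ≡ w
    eq′ = suc-injective (trans (≡.sym (#-−-∈ W v p)) eq)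
    h′ : PairwiseAdjacent G (W − v)
    h′ i j a b = h i j (proj₁ (−-elim {A = W} a)) (proj₁ (−-elim {A = W} b))
    ⊆N : W − v ⊆ W ∩ adj G v
    ⊆N i e with a , ne ← −-elim {A = W} e = ∧-intro a (h v i p a (ne ∘ ≡.sym))

-- The clique bound and the extremal graphs

listSum-tabulate : ∀ {n} {A : Set} (f : A → ℕ) (h : Fin n → A) → ListAction.sum (List.map f (List.tabulate h)) ≡ sum (f ∘ h)
listSum-tabulate {zero} f h = refl
listSum-tabulate {suc n} f h = cong (f (h zero) +_) (listSum-tabulate f (h ∘ suc))

deg≡# : ∀ {n} (G : Graph n) x → deg G x ≡ # (adj G x)
deg≡# G x = listSum-tabulate (⟦_⟧ ∘ adj G x) id

-- Removes `r` vertices of `V₀` one at a time. A clique through such a vertex has its other vertices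
-- in `V₁`, so each removal costs at most `# V₁ C ℓ`; the `w` vertices left over get the trivial
-- bound.
cliques-peel-≤ : ∀ {n} (G : Graph n) ℓ (V₀ V₁ : VSet n) → (∀ x → V₀ x ≡ true → adj G x ⊆ V₁) →
  ∀ r {W w} → # W ≡ r + w → r ≤ # (W ∩ V₀) → cliques G (suc ℓ) W ≤ w C suc ℓ + r * (# V₁ C ℓ)
cliques-peel-≤ G ℓ V₀ V₁ N⊆V₁ zero {W} refl _ = ≤-trans (cliques≤C G (suc ℓ) W) (m≤m+n _ 0)
cliques-peel-≤ G ℓ V₀ V₁ N⊆V₁ (suc r) {W} {w} eq r<
  with x , p ← 0<#⇒∈ (W ∩ V₀) (≤-trans (s≤s z≤n) r<) with x∈W , x∈V₀ ← ∧-elim p = begin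
  cliques G (suc ℓ) W                                    ≤⟨ cliques-step-≤ G ℓ W x ⟩
  cliques G (suc ℓ) (W − x) + cliques G ℓ (W ∩ adj G x)  ≤⟨ +-mono-≤ rest (≤-trans (cliques-mono G ℓ nbrs) (cliques≤C G ℓ V₁)) ⟩
  w C suc ℓ + r * (# V₁ C ℓ) + # V₁ C ℓ                  ≡⟨ +-assoc (w C suc ℓ) _ _ ⟩
  w C suc ℓ + (r * (# V₁ C ℓ) + # V₁ C ℓ)                ≡⟨ cong (w C suc ℓ +_) (+-comm (r * (# V₁ C ℓ)) _) ⟩
  w C suc ℓ + suc r * (# V₁ C ℓ)                         ∎
  where
  open ≤-Reasoning
  nbrs : W ∩ adj G x ⊆ V₁
  nbrs i e = N⊆V₁ x x∈V₀ i (proj₂ (∧-elim {W i} e))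
  −-∩ : W ∩ V₀ − x ⊆ (W − x) ∩ V₀
  −-∩ i e = let a , ne = −-elim {A = W ∩ V₀} e ; b , c = ∧-elim a in ∧-intro (−-intro {A = W} b ne) c
  rest : cliques G (suc ℓ) (W − x) ≤ w C suc ℓ + r * (# V₁ C ℓ)
  rest = cliques-peel-≤ G ℓ V₀ V₁ N⊆V₁ r
    (suc-injective (trans (≡.sym (#-−-∈ W x x∈W)) eq))
    (≤-trans (s≤s⁻¹ (≤-trans r< (≤-reflexive (#-−-∈ (W ∩ V₀) x p)))) (#-mono −-∩))

-- With n = k + 1 + c, this is g_{ℓ+1}(n, k/2, t) without the cliques through u.
φ : (k c ℓ t : ℕ) → ℕ
φ k c ℓ t = (k ∸ t) C suc ℓ + (c + t) * (t C ℓ)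

-- The `suc (k + c)` vertices are split into `v`, then `c + # V₁` vertices of `V₀`, then `k ∸ # V₁`
-- remaining ones.
NK-upper : ∀ {n k c} → n ≡ suc (k + c) → (G : Graph n) → ∀ ℓ (V₀ V₁ : VSet n) →
  (∀ x → V₀ x ≡ true → adj G x ⊆ V₁) → # V₁ ≤ k → suc (c + # V₁) ≤ # V₀ →
  ∀ v → NK (suc ℓ) G ≤ φ k c ℓ (# V₁) + deg G v C ℓ
NK-upper {n} {k} {c} n≡ G ℓ V₀ V₁ N⊆V₁ t≤k big v = begin
  NK (suc ℓ) G                                                 ≡⟨ NK≡cliques G (suc ℓ) ⟩
  cliques G (suc ℓ) full                                       ≤⟨ cliques-step-≤ G ℓ full v ⟩
  cliques G (suc ℓ) (full − v) + cliques G ℓ (full ∩ adj G v)  ≤⟨ +-mono-≤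
    (cliques-peel-≤ G ℓ V₀ V₁ N⊆V₁ (c + # V₁) size enough) (cliques≤C G ℓ (adj G v)) ⟩
  φ k c ℓ (# V₁) + # (adj G v) C ℓ                             ≡⟨ cong (λ d → φ k c ℓ (# V₁) + d C ℓ) (deg≡# G v) ⟨
  φ k c ℓ (# V₁) + deg G v C ℓ                                 ∎
  where
  open ≤-Reasoning
  size : # (full − v) ≡ (c + # V₁) + (k ∸ # V₁)
  size = trans (suc-injective (trans (≡.sym (#-−-∈ full v refl)) (trans (#-full n) n≡)))
    (trans (+-comm k c) (trans (cong (c +_) (≡.sym (m+[n∸m]≡n t≤k))) (≡.sym (+-assoc c (# V₁) _))))
  V₀−v⊆ : V₀ − v ⊆ (full − v) ∩ V₀
  V₀−v⊆ i e = let a , ne = −-elim {A = V₀} e in ∧-intro (−-intro {A = full} refl ne) a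
  -- `v` may itself lie in `V₀`; the `suc` in the bound on `# V₀` pays for its removal.
  enough : c + # V₁ ≤ # ((full − v) ∩ V₀)
  enough = ≤-trans (s≤s⁻¹ (≤-trans big (≤-trans (≤-reflexive (#-− V₀ v))
    (≤-trans (+-monoʳ-≤ (# (V₀ − v)) (⟦⟧≤1 (V₀ v))) (≤-reflexive (+-comm _ 1)))))) (#-mono V₀−v⊆)

<ᵇ-true : ∀ {a b} → a < b → (a <ᵇ b) ≡ true
<ᵇ-true = Equivalence.to T-≡ ∘ <⇒<ᵇ

<ᵇ-sound : ∀ a b → (a <ᵇ b) ≡ true → a < b
<ᵇ-sound a b = <ᵇ⇒< a b ∘ Equivalence.from T-≡

below : ∀ {n} → ℕ → VSet n
below j i = toℕ i <ᵇ j

#-below : ∀ {n j} → j ≤ n → # (below {n} j) ≡ j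
#-below {n} z≤n = sum-replicate-zero n
#-below (s≤s h) = cong suc (#-below h)

extAdj-< : ∀ n k δ t a b → a < b → extE n k δ t a b ≡ true → extAdj n k δ t a b ≡ true
extAdj-< n k δ t a b a<b e
  rewrite m≤n⇒m⊓n≡m (<⇒≤ a<b) | m≤n⇒m⊔n≡n (<⇒≤ a<b) =
  ∧-intro (not-intro (<⇒≢ a<b ∘ ≡ᵇ-sound a b)) e

-- The extremal graph is built up in the order of its numbering: the first `k ∸ t` vertices form a
-- clique, each of the next `c + t` is joined to the first `t`, and the last one, `u`, to the first
-- `δ`.
module LowerBound (k c δ t : ℕ) (δ≤t : δ ≤ t) (2t≤k : t + t ≤ k) where

  -- In this form `n ∸ 1` computes to `k + c`, the number of `u`.
  n : ℕ
  n = suc (k + c)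

  H : Graph n
  H = Gext n k δ t

  t≤k∸t : t ≤ k ∸ t
  t≤k∸t = m+n≤o⇒m≤o∸n t 2t≤k

  k∸t≤k+c : k ∸ t ≤ k + c
  k∸t≤k+c = ≤-trans (m∸n≤m k t) (m≤m+n k c)

  extE-core : ∀ a b → b < k ∸ t → extE n k δ t a b ≡ true
  extE-core a b b< with b <ᵇ t
  ... | true = refl
  ... | false with a <ᵇ t
  ...   | false = <ᵇ-true b<
  ...   | true with b ≡ᵇ (k + c) in eq
  ...     | false = refl
  ...     | true = contradiction (≡ᵇ-sound b _ eq) (<⇒≢ (<-≤-trans b< k∸t≤k+c))

  extE-indep : ∀ {a b} → a < t → b < k + c → extE n k δ t a b ≡ true
  extE-indep {a} {b} a<t b< with b <ᵇ t
  ... | true = refl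
  ... | false rewrite <ᵇ-true a<t with b ≡ᵇ (k + c) in eq
  ...   | false = refl
  ...   | true = contradiction (≡ᵇ-sound b _ eq) (<⇒≢ b<)

  extE-last : ∀ {a} → a < δ → extE n k δ t a (k + c) ≡ true
  extE-last {a} a<δ with (k + c) <ᵇ t
  ... | true = refl
  ... | false rewrite <ᵇ-true (<-≤-trans a<δ δ≤t) | ≡ᵇ-refl (k + c) = <ᵇ-true a<δ

  core-adj : PairwiseAdjacent H (below (k ∸ t))
  core-adj i j p q i≢j with <-cmp (toℕ i) (toℕ j)
  ... | tri< lt _ _ = extAdj-< n k δ t (toℕ i) (toℕ j) lt (extE-core _ (toℕ j) (<ᵇ-sound _ _ q))
  ... | tri≈ _ eq _ = contradiction (toℕ-injective eq) i≢j
  ... | tri> _ _ gt = trans (extAdj-sym n k δ t (toℕ i) (toℕ j)) (extAdj-< n k δ t (toℕ j) (toℕ i) gt (extE-core _ (toℕ i) (<ᵇ-sound _ _ p)))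

  below-⊆ : ∀ {a b} → a ≤ b → below {n} a ⊆ below b
  below-⊆ a≤b i p = <ᵇ-true (<-≤-trans (<ᵇ-sound _ _ p) a≤b)

  below-C : ∀ {j} → j ≤ k ∸ t → ∀ ℓ → j C ℓ ≤ cliques H ℓ (below j)
  below-C {j} j≤ ℓ = ≤-trans (≤-reflexive (cong (_C ℓ) (≡.sym (#-below {n} (≤-trans j≤ (≤-trans k∸t≤k+c (n≤1+n _)))))))
    (C≤cliques H ℓ (below j) λ i i′ p q → core-adj i i′ (below-⊆ j≤ i p) (below-⊆ j≤ i′ q))

  -- The new vertex `j` is joined to the first `s` vertices. These lie in the core and form a
  -- clique, so at least `s C ℓ` cliques pass through `j`.
  cliques-add : ∀ ℓ {j s} (j<n : j < n) → s ≤ j → s ≤ k ∸ t → (∀ {a} → a < s → extE n k δ t a j ≡ true) →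
    cliques H (suc ℓ) (below j) + s C ℓ ≤ cliques H (suc ℓ) (below (suc j))
  cliques-add ℓ {j} {s} j<n s≤j s≤ E = ≤-trans
    (+-mono-≤ (cliques-mono H (suc ℓ) lower) (≤-trans (below-C s≤ ℓ) (cliques-mono H ℓ nbrs)))
    (cliques-step-≥ H ℓ (below (suc j)) v (<ᵇ-true (s≤s (≤-reflexive v≡j))))
    where
    v : Fin n
    v = fromℕ< j<n
    v≡j : toℕ v ≡ j
    v≡j = toℕ-fromℕ< j<n
    lower : below j ⊆ below (suc j) − v
    lower i p = −-intro {A = below (suc j)} {v} {i} (below-⊆ (n≤1+n j) i p)
      λ { refl → <⇒≢ (<ᵇ-sound _ _ p) v≡j }
    nbrs : below s ⊆ below (suc j) ∩ adj H v
    nbrs i p = ∧-intro (below-⊆ (≤-trans s≤j (n≤1+n j)) i p)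
      (trans (extAdj-sym n k δ t (toℕ v) (toℕ i))
        (extAdj-< n k δ t (toℕ i) (toℕ v) (<-≤-trans i<s (≤-trans s≤j (≤-reflexive (≡.sym v≡j))))
          (trans (cong (extE n k δ t (toℕ i)) v≡j) (E i<s))))
      where
      i<s : toℕ i < s
      i<s = <ᵇ-sound _ _ p

  -- Adds `d` vertices with `s = t`. The hypothesis stops the segment before `u`, whose degree is
  -- different.
  cliques-core : ∀ ℓ d → k ∸ t + d ≤ k + c →
    (k ∸ t) C suc ℓ + d * (t C ℓ) ≤ cliques H (suc ℓ) (below (k ∸ t + d))
  cliques-core ℓ zero _ rewrite +-identityʳ (k ∸ t) | +-identityʳ ((k ∸ t) C suc ℓ) = below-C ≤-refl (suc ℓ)
  cliques-core ℓ (suc d) le = begin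
    (k ∸ t) C suc ℓ + suc d * (t C ℓ)                       ≡⟨ cong ((k ∸ t) C suc ℓ +_) (+-comm (t C ℓ) _) ⟩
    (k ∸ t) C suc ℓ + (d * (t C ℓ) + t C ℓ)                 ≡⟨ +-assoc ((k ∸ t) C suc ℓ) _ _ ⟨
    (k ∸ t) C suc ℓ + d * (t C ℓ) + t C ℓ                   ≤⟨ +-monoˡ-≤ (t C ℓ) (cliques-core ℓ d (<⇒≤ j<)) ⟩
    cliques H (suc ℓ) (below (k ∸ t + d)) + t C ℓ           ≤⟨ cliques-add ℓ (<-trans j< ≤-refl) (≤-trans t≤k∸t (m≤m+n _ d)) t≤k∸t (λ a< → extE-indep a< j<) ⟩
    cliques H (suc ℓ) (below (suc (k ∸ t + d)))             ≡⟨ cong (λ j → cliques H (suc ℓ) (below j)) (+-suc (k ∸ t) d) ⟨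
    cliques H (suc ℓ) (below (k ∸ t + suc d))               ∎
    where
    open ≤-Reasoning
    j< : k ∸ t + d < k + c
    j< = ≤-trans (≤-reflexive (≡.sym (+-suc (k ∸ t) d))) le

  g-lower : ∀ ℓ → φ k c ℓ t + δ C ℓ ≤ g (suc ℓ) n k δ t
  g-lower ℓ = begin
    φ k c ℓ t + δ C ℓ                                             ≤⟨ +-monoˡ-≤ (δ C ℓ) (cliques-core ℓ (c + t) (≤-reflexive top)) ⟩
    cliques H (suc ℓ) (below (k ∸ t + (c + t))) + δ C ℓ           ≡⟨ cong (λ j → cliques H (suc ℓ) (below j) + δ C ℓ) top ⟩
    -- The last vertex added is `u`, now with `s = δ`.
    cliques H (suc ℓ) (below (k + c)) + δ C ℓ                     ≤⟨ cliques-add ℓ ≤-refl (≤-trans δ≤k∸t k∸t≤k+c) δ≤k∸t extE-last ⟩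
    cliques H (suc ℓ) (below n)                                   ≤⟨ cliques-mono H (suc ℓ) (λ _ _ → refl) ⟩
    cliques H (suc ℓ) full                                        ≡⟨ NK≡cliques H (suc ℓ) ⟨
    g (suc ℓ) n k δ t                                             ∎
    where
    open ≤-Reasoning
    δ≤k∸t : δ ≤ k ∸ t
    δ≤k∸t = ≤-trans δ≤t t≤k∸t
    top : k ∸ t + (c + t) ≡ k + c
    top = trans (cong (k ∸ t +_) (+-comm c t)) (trans (≡.sym (+-assoc (k ∸ t) t c))
      (cong (_+ c) (m∸n+n≡m (≤-trans (m≤m+n t t) 2t≤k))))

-- Convexity of the bound

C-monoˡ-≤ : ∀ {m n} k → m ≤ n → m C k ≤ n C k
C-monoˡ-≤ zero _ = ≤-refl
C-monoˡ-≤ {n = n} (suc k) z≤n = z≤n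
C-monoˡ-≤ {suc m} {suc n} (suc k) (s≤s h) = ≤-trans (≤-reflexive (≡.sym (nCk+nC[k+1]≡[n+1]C[k+1] m k)))
  (≤-trans (+-mono-≤ (C-monoˡ-≤ k h) (C-monoˡ-≤ (suc k) h)) (≤-reflexive (nCk+nC[k+1]≡[n+1]C[k+1] n k)))

-- φ is convex in t: it drops by D t and gains U t from t to t + 1, where D
-- is decreasing and U is increasing.
module Convexity (k c p : ℕ) where

  ℓ : ℕ
  ℓ = suc p

  D U : ℕ → ℕ
  D t = (k ∸ suc t) C ℓ
  U t = t C ℓ + (c + suc t) * (t C p)

  -- Pascal's rule in both terms of `φ`. The drop `D t` stands on the left to avoid truncated
  -- subtraction.
  φ-suc : ∀ {t} → t < k → φ k c ℓ (suc t) + D t ≡ φ k c ℓ t + U t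
  φ-suc {t} t<k = begin
    X + (c + suc t) * (suc t C ℓ) + D t                        ≡⟨ cong (λ z → X + (c + suc t) * z + D t) (nCk+nC[k+1]≡[n+1]C[k+1] t p) ⟨
    X + (c + suc t) * (t C p + t C ℓ) + D t                    ≡⟨ rearrange X c t (t C p) (t C ℓ) (D t) ⟩
    D t + X + (c + t) * (t C ℓ) + U t                          ≡⟨ cong (λ z → z + (c + t) * (t C ℓ) + U t) (nCk+nC[k+1]≡[n+1]C[k+1] (k ∸ suc t) ℓ) ⟩
    suc (k ∸ suc t) C suc ℓ + (c + t) * (t C ℓ) + U t          ≡⟨ cong (λ z → z C suc ℓ + (c + t) * (t C ℓ) + U t) (+-∸-assoc 1 t<k) ⟨
    φ k c ℓ t + U t                                            ∎
    where
    open ≡.≡-Reasoning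
    X : ℕ
    X = (k ∸ suc t) C suc ℓ
    rearrange : ∀ x c t a b d → x + (c + suc t) * (a + b) + d ≡ d + x + (c + t) * b + (b + (c + suc t) * a)
    rearrange = solve-∀

  D-anti : ∀ t → D (suc t) ≤ D t
  D-anti t = C-monoˡ-≤ ℓ (∸-monoʳ-≤ k (n≤1+n (suc t)))

  U-mono : ∀ t → U t ≤ U (suc t)
  U-mono t = +-mono-≤ (C-monoˡ-≤ ℓ (n≤1+n t)) (*-mono-≤ (+-monoʳ-≤ c (n≤1+n (suc t))) (C-monoˡ-≤ p (n≤1+n t)))

  φ-up : ∀ {t} → t < k → D t ≤ U t → φ k c ℓ t ≤ φ k c ℓ (suc t)
  φ-up {t} t<k D≤U = +-cancelʳ-≤ (U t) _ _ (≤-trans (≤-reflexive (≡.sym (φ-suc t<k))) (+-monoʳ-≤ _ D≤U))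

  φ-down : ∀ {t} → t < k → U t ≤ D t → φ k c ℓ (suc t) ≤ φ k c ℓ t
  φ-down {t} t<k U≤D = +-cancelʳ-≤ (D t) _ _ (≤-trans (≤-reflexive (φ-suc t<k)) (+-monoʳ-≤ _ U≤D))

  -- Once a step goes up, so do all later ones. The condition `D T ≤ U T` is returned as well
  -- because the induction needs it at each step.
  φ-increasing : ∀ {t T} → t ≤′ T → T ≤ k → D t ≤ U t → φ k c ℓ t ≤ φ k c ℓ T × D T ≤ U T
  φ-increasing ≤′-refl _ D≤U = ≤-refl , D≤U
  φ-increasing {t} {suc T} (≤′-step h) T<k D≤U with le , D≤U′ ← φ-increasing h (<⇒≤ T<k) D≤U =
    ≤-trans le (φ-up T<k D≤U′) , ≤-trans (D-anti T) (≤-trans D≤U′ (U-mono T))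

  -- Looks at the step that leads to `suc t`. If it goes down, `φ` is at least as large at `t`, and
  -- the induction continues towards `a`; if it goes up, `φ` keeps growing as far as `T`.
  φ≤max-endpoints : ∀ {a t T} → a ≤′ t → t ≤ T → T ≤ k → φ k c ℓ t ≤ φ k c ℓ a ⊔ φ k c ℓ T
  φ≤max-endpoints ≤′-refl _ _ = m≤m⊔n _ _
  φ≤max-endpoints {a} {suc t} {T} (≤′-step h) t<T T≤k with ≤-total (D t) (U t)
  ... | inj₂ U≤D = ≤-trans (φ-down (≤-trans t<T T≤k) U≤D) (φ≤max-endpoints h (<⇒≤ t<T) T≤k)
  ... | inj₁ D≤U = ≤-trans (proj₁ (φ-increasing (≤⇒≤′ t<T) T≤k (≤-trans (D-anti t) (≤-trans D≤U (U-mono t)))))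
                     (m≤n⊔m _ _)

-- König's theorem

Rel : ℕ → Set
Rel n = Fin n → Fin n → Bool

∥_∥ : ∀ {n} → Rel n → ℕ
∥ E ∥ = sum (λ i → # (E i))

∅ⱽ : ∀ {n} → VSet n
∅ⱽ _ = false

⁅_⁆ : ∀ {n} → Fin n → VSet n
⁅ x ⁆ i = toℕ i ≡ᵇ toℕ x

#-insert : ∀ {n} (A : VSet n) x → # (A ∪ ⁅ x ⁆) ≤ suc (# A)
#-insert A x = begin
  # (A ∪ ⁅ x ⁆)                    ≤⟨ m≤n+m _ _ ⟩
  # (A ∩ ⁅ x ⁆) + # (A ∪ ⁅ x ⁆)    ≡⟨ #-∩-∪ A ⁅ x ⁆ ⟩
  # A + # ⁅ x ⁆                    ≡⟨ cong (# A +_) (sum-point (λ _ → 1) x) ⟩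
  # A + 1                          ≡⟨ +-comm (# A) 1 ⟩
  suc (# A)                        ∎
  where open ≤-Reasoning

Covers : ∀ {n} → VSet n → VSet n → Rel n → Set
Covers A B E = ∀ i j → E i j ≡ true → A i ≡ true ⊎ B j ≡ true

-- The vertex cover consists of A on the left and B on the right side of the
-- bipartite graph E.
record König {n} (E : Rel n) : Set where
  field
    M     : Rel n
    M⊆E   : ∀ i → M i ⊆ E i
    row≤1 : ∀ i → # (M i) ≤ 1
    col≤1 : ∀ j → # (flip M j) ≤ 1
    A B   : VSet n
    cover : Covers A B E
    tight : # A + # B ≤ ∥ M ∥

könig-transpose : ∀ {n} {E : Rel n} → König (flip E) → König E
könig-transpose K = record
  { M = flip M ; M⊆E = λ i j → M⊆E j i ; row≤1 = col≤1 ; col≤1 = row≤1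
  ; A = B ; B = A
  ; cover = λ i j e → swap (cover j i e)
  ; tight = ≤-trans (≤-reflexive (+-comm (# B) (# A)))
      (≤-trans tight (≤-reflexive (∑-comm (λ i j → ⟦ M i j ⟧))))
  }
  where open König K

LeftUnique : ∀ {n} → Rel n → Set
LeftUnique E = ∀ i j j′ → E i j ≡ true → E i j′ ≡ true → j ≡ j′

-- Base case of the induction: `E` is its own matching, and its left endpoints cover every edge.
könig-matching : ∀ {n} (E : Rel n) → LeftUnique E → LeftUnique (flip E) → König E
könig-matching {n} E left right = record
  { M = E ; M⊆E = λ _ _ e → e
  ; row≤1 = λ i → atMostOne⇒#≤1 (E i) (left i)
  ; col≤1 = λ j → atMostOne⇒#≤1 (flip E j) (right j)
  ; A = λ i → 0 <ᵇ # (E i) ; B = ∅ⱽ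
  ; cover = λ i j e → inj₁ (<ᵇ-true (∈⇒0<# (E i) j e))
  ; tight = ≤-trans (+-mono-≤ (sum-mono λ i → lem (# (E i))) (≤-reflexive (sum-replicate-zero n))) (≤-reflexive (+-identityʳ _))
  }
  where
  lem : ∀ m → ⟦ 0 <ᵇ m ⟧ ≤ m
  lem zero = z≤n
  lem (suc m) = s≤s z≤n

delete : ∀ {n} → Rel n → Fin n → Fin n → Rel n
delete E x y i j = E i j ∧ not (⁅ x ⁆ i ∧ ⁅ y ⁆ j)

delete⊆ : ∀ {n} (E : Rel n) x y i → delete E x y i ⊆ E i
delete⊆ E x y i j e = proj₁ (∧-elim e)

delete-intro : ∀ {n} (E : Rel n) x y i j → E i j ≡ true → ¬ (i ≡ x × j ≡ y) → delete E x y i j ≡ true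
delete-intro E x y i j e ne = ∧-intro e (not-intro λ q → let a , b = ∧-elim {⁅ x ⁆ i} q in
  ne (toℕ-injective (≡ᵇ-sound _ _ a) , toℕ-injective (≡ᵇ-sound _ _ b)))

∥delete∥ : ∀ {n} (E : Rel n) x y → E x y ≡ true → ∥ delete E x y ∥ < ∥ E ∥
∥delete∥ E x y e = sum-mono-< (λ i → #-mono (delete⊆ E x y i)) x
  (sum-mono-< (λ j → ⟦⟧-mono (delete⊆ E x y x j)) y lt)
  where
  lt : ⟦ delete E x y x y ⟧ < ⟦ E x y ⟧
  lt rewrite e | ≡ᵇ-refl (toℕ x) | ≡ᵇ-refl (toℕ y) = ≤-refl

-- A matching of the smaller relation is also one of `E`, so only a new cover has to be supplied.
könig-recover : ∀ {n} {E E′ : Rel n} (K : König E′) → (∀ i → E′ i ⊆ E i) → (A B : VSet n) →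
  Covers A B E → # A + # B ≤ ∥ König.M K ∥ → König E
könig-recover K E′⊆E A B cov le = record
  { M = M ; M⊆E = λ i j m → E′⊆E i j (M⊆E i j m) ; row≤1 = row≤1 ; col≤1 = col≤1
  ; A = A ; B = B ; cover = cov ; tight = le }
  where open König K using (M; M⊆E; row≤1; col≤1)

könig-restore : ∀ {n} (E : Rel n) x y (K : König (delete E x y)) →
  König.A K x ∨ König.B K y ≡ true → König E
könig-restore E x y K covered = könig-recover K (delete⊆ E x y) A B cov tight
  where
  open König K
  cov : Covers A B E
  cov i j e with i Fin.≟ x | j Fin.≟ y
  ... | yes refl | yes refl = ∨-elim covered
  ... | no i≢x   | _        = cover i j (delete-intro E x y i j e (i≢x ∘ proj₁))
  ... | _        | no j≢y   = cover i j (delete-intro E x y i j e (j≢y ∘ proj₂))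

-- Lovász's uncrossing argument: if neither cover covers the deleted edge, then
-- (A₁ ∩ A₂, B₁ ∪ B₂) and (A₁ ∪ A₂ ∪ {x}, B₁ ∩ B₂) both cover E, and one of
-- them is small enough.
könig-step : ∀ {n} (E : Rel n) x y z → y ≢ z → E x y ≡ true → E x z ≡ true →
  König (delete E x y) → König (delete E x z) → König E
könig-step {n} E x y z y≢z xy xz K₁ K₂
  with König.A K₁ x ∨ König.B K₁ y in c₁ | König.A K₂ x ∨ König.B K₂ z in c₂
... | true  | _     = könig-restore E x y K₁ c₁
... | false | true  = könig-restore E x z K₂ c₂
... | false | false = uncrossed
  where
  open König K₁ using () renaming (A to A₁; B to B₁; M to M₁; cover to cover₁; tight to tight₁)
  open König K₂ using () renaming (A to A₂; B to B₂; M to M₂; cover to cover₂; tight to tight₂)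

  -- The edge `x y` survives the deletion of `x z`, and `x` is not in `A₂`; so `y` must be in `B₂`.
  -- `B₁z` is symmetric.
  B₂y : B₂ y ≡ true
  B₂y with cover₂ x y (delete-intro E x z x y xy (y≢z ∘ proj₂))
  ... | inj₁ a = case trans (≡.sym (∨-introˡ a)) c₂ of λ ()
  ... | inj₂ b = b

  B₁z : B₁ z ≡ true
  B₁z with cover₁ x z (delete-intro E x y x z xz (y≢z ∘ ≡.sym ∘ proj₂))
  ... | inj₁ a = case trans (≡.sym (∨-introˡ a)) c₁ of λ ()
  ... | inj₂ b = b

  -- Edges at `y` or `z` are covered on the right; every other edge survives both deletions and is
  -- covered twice.
  cov∩∪ : Covers (A₁ ∩ A₂) (B₁ ∪ B₂) E
  cov∩∪ i j e with j Fin.≟ y | j Fin.≟ z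
  ... | yes refl | _        = inj₂ (∨-introʳ {B₁ j} B₂y)
  ... | no _     | yes refl = inj₂ (∨-introˡ B₁z)
  ... | no j≢y   | no j≢z
    with cover₁ i j (delete-intro E x y i j e (j≢y ∘ proj₂)) | cover₂ i j (delete-intro E x z i j e (j≢z ∘ proj₂))
  ...   | inj₁ a | inj₁ b = inj₁ (∧-intro a b)
  ...   | inj₂ a | _      = inj₂ (∨-introˡ a)
  ...   | _      | inj₂ b = inj₂ (∨-introʳ {B₁ j} b)

  cov∪∩ : Covers (A₁ ∪ A₂ ∪ ⁅ x ⁆) (B₁ ∩ B₂) E
  cov∪∩ i j e with i Fin.≟ x
  ... | yes refl = inj₁ (∨-introʳ {A₁ i ∨ A₂ i} (≡ᵇ-refl (toℕ i)))
  ... | no i≢x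
    with cover₁ i j (delete-intro E x y i j e (i≢x ∘ proj₁)) | cover₂ i j (delete-intro E x z i j e (i≢x ∘ proj₁))
  ...   | inj₂ a | inj₂ b = inj₂ (∧-intro a b)
  ...   | inj₁ a | _      = inj₁ (∨-introˡ (∨-introˡ a))
  ...   | _      | inj₁ b = inj₁ (∨-introˡ (∨-introʳ {A₁ i} b))

  p q : ℕ
  p = # (A₁ ∩ A₂) + # (B₁ ∪ B₂)
  q = # (A₁ ∪ A₂) + # (B₁ ∩ B₂)

  p+q≤ : p + q ≤ ∥ M₁ ∥ + ∥ M₂ ∥
  p+q≤ = begin
    p + q                                                                ≡⟨ interchange (# (A₁ ∩ A₂)) _ _ _ ⟩
    (# (A₁ ∩ A₂) + # (A₁ ∪ A₂)) + (# (B₁ ∪ B₂) + # (B₁ ∩ B₂))            ≡⟨ cong₂ _+_ (#-∩-∪ A₁ A₂) (trans (+-comm (# (B₁ ∪ B₂)) _) (#-∩-∪ B₁ B₂)) ⟩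
    (# A₁ + # A₂) + (# B₁ + # B₂)                                        ≡⟨ interchange (# A₁) _ _ _ ⟩
    (# A₁ + # B₁) + (# A₂ + # B₂)                                        ≤⟨ +-mono-≤ tight₁ tight₂ ⟩
    ∥ M₁ ∥ + ∥ M₂ ∥                                                      ∎
    where open ≤-Reasoning

  uncrossed : König E
  uncrossed with p ≤? ∥ M₁ ∥
  ... | yes p≤ = könig-recover K₁ (delete⊆ E x y) (A₁ ∩ A₂) (B₁ ∪ B₂) cov∩∪ p≤
  -- Here `p > ∥ M₁ ∥` forces `q < ∥ M₂ ∥`, and the spare unit pays for adding `x`.
  ... | no p≰ = könig-recover K₂ (delete⊆ E x z) (A₁ ∪ A₂ ∪ ⁅ x ⁆) (B₁ ∩ B₂) cov∪∩
    (≤-trans (+-monoˡ-≤ (# (B₁ ∩ B₂)) (#-insert (A₁ ∪ A₂) x))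
      (+-cancelˡ-≤ ∥ M₁ ∥ _ _ (≤-trans (≤-reflexive (+-suc ∥ M₁ ∥ q)) (≤-trans (+-monoˡ-≤ q (≰⇒> p≰)) p+q≤))))

leftUnique? : ∀ {n} (E : Rel n) →
  (∃ λ x → ∃ λ y → ∃ λ z → y ≢ z × E x y ≡ true × E x z ≡ true) ⊎ LeftUnique E
leftUnique? E with any? (λ x → any? λ y → any? λ z → ¬? (y Fin.≟ z) ×-dec (E x y ≟ᵇ true ×-dec E x z ≟ᵇ true))
... | yes h = inj₁ h
... | no ¬h = inj₂ λ i j j′ p q → decidable-stable (j Fin.≟ j′) λ ne → ¬h (i , j , j′ , ne , p , q)

könig : ∀ {n} (E : Rel n) → König E
könig E = go (suc ∥ E ∥) E ≤-refl
  where
  -- Induction on the number of edges, bounded by `N`. A vertex with two edges, on either side,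
  -- allows an uncrossing step; without one, `E` is a matching.
  go : ∀ {n} N (E : Rel n) → ∥ E ∥ < N → König E
  go (suc N) E (s≤s h) with leftUnique? E | leftUnique? (flip E)
  ... | inj₁ (x , y , z , ne , xy , xz) | _ = könig-step E x y z ne xy xz
    (go N (delete E x y) (≤-trans (∥delete∥ E x y xy) h)) (go N (delete E x z) (≤-trans (∥delete∥ E x z xz) h))
  ... | inj₂ _ | inj₁ (x , y , z , ne , xy , xz) = könig-transpose (könig-step (flip E) x y z ne xy xz
    (go N (delete (flip E) x y) (≤-trans (∥delete∥ (flip E) x y xy) h′))
    (go N (delete (flip E) x z) (≤-trans (∥delete∥ (flip E) x z xz) h′)))
    where
    h′ : ∥ flip E ∥ ≤ N
    h′ = ≤-trans (≤-reflexive (∑-comm (λ i j → ⟦ E j i ⟧))) h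
  ... | inj₂ left | inj₂ right = könig-matching E left right

-- Fractional matchings

-- The matching constructed from the double cover is half-integral, so its sums can be computed on
-- numerators in `ℕ`.
half : ℕ → ℚ
half c = ℤ.+ c / 2

-- `mkℚᵘ` takes the denominator minus one: the right side is c/2 without cancellation, where
-- arithmetic reduces to that of integers.
half-≃ : ∀ c → ℚ.toℚᵘ (half c) ℚᵘ.≃ mkℚᵘ (ℤ.+ c) 1
half-≃ c = ℚ.toℚᵘ-fromℚᵘ (mkℚᵘ (ℤ.+ c) 1)

half-+ : ∀ a b → half a ℚ.+ half b ≡ half (a + b)
half-+ a b = ℚ.toℚᵘ-injective (ℚᵘ.≃-trans (ℚ.toℚᵘ-homo-+ (half a) (half b))
  (ℚᵘ.≃-trans (ℚᵘ.+-cong (half-≃ a) (half-≃ b))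
    (ℚᵘ.≃-trans (*≡* (identity (ℤ.+ a) (ℤ.+ b))) (ℚᵘ.≃-sym (half-≃ (a + b))))))
  where
  identity : ∀ i j → (i ℤ.* ℤ.+ 2 ℤ.+ j ℤ.* ℤ.+ 2) ℤ.* ℤ.+ 2 ≡ (i ℤ.+ j) ℤ.* ℤ.+ 4
  identity = ℤSolver.solve-∀

half-mono : ∀ a b → a ≤ b → half a ℚ.≤ half b
half-mono a b a≤b = ℚ.toℚᵘ-cancel-≤ (ℚᵘ.≤-respˡ-≃ (ℚᵘ.≃-sym (half-≃ a)) (ℚᵘ.≤-respʳ-≃ (ℚᵘ.≃-sym (half-≃ b))
  (*≤* (ℤ.*-monoʳ-≤-nonNeg (ℤ.+ 2) (ℤ.+≤+ a≤b)))))

half-cancel : ∀ a b → half a ℚ.≤ half b → a ≤ b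
half-cancel a b h with ℚᵘ.≤-respˡ-≃ (half-≃ a) (ℚᵘ.≤-respʳ-≃ (half-≃ b) (ℚ.toℚᵘ-mono-≤ h))
... | *≤* le = ℤ.drop‿+≤+ (ℤ.*-cancelʳ-≤-pos (ℤ.+ a) (ℤ.+ b) (ℤ.+ 2) le)

sumℚ-half : ∀ {A : Set} (c : A → ℕ) xs → sumℚ (List.map (half ∘ c) xs) ≡ half (ListAction.sum (List.map c xs))
sumℚ-half c [] = refl
sumℚ-half c (x ∷ xs) = trans (cong (half (c x) ℚ.+_) (sumℚ-half c xs)) (half-+ (c x) _)

listSum-concatMap : ∀ {A B : Set} (c : B → ℕ) (h : A → List B) xs →
  ListAction.sum (List.map c (List.concatMap h xs)) ≡ ListAction.sum (List.map (λ x → ListAction.sum (List.map c (h x))) xs)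
listSum-concatMap c h [] = refl
listSum-concatMap c h (x ∷ xs) = trans (cong ListAction.sum (map-++ c (h x) _))
  (trans (sum-++ (List.map c (h x)) _) (cong (_ +_) (listSum-concatMap c h xs)))

listSum-filterᵇ : ∀ {A : Set} (c : A → ℕ) (p : A → Bool) xs →
  ListAction.sum (List.map c (filterᵇ p xs)) ≡ ListAction.sum (List.map (λ x → if p x then c x else 0) xs)
listSum-filterᵇ c p [] = refl
listSum-filterᵇ c p (x ∷ xs) with p x
... | true = cong (c x +_) (listSum-filterᵇ c p xs)
... | false = listSum-filterᵇ c p xs

isEdge : ∀ {n} → Graph n → Rel n
isEdge G i j = (toℕ i <ᵇ toℕ j) ∧ adj G i j

edgeAt : ∀ {n} → Graph n → Fin n → Fin n → List (Fin n × Fin n)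
edgeAt G i j = if isEdge G i j then (i , j) ∷ [] else []

edgesFrom : ∀ {n} → Graph n → Fin n → List (Fin n × Fin n)
edgesFrom {n} G i = List.concatMap (edgeAt G i) (allFin n)

-- Replaces the list of edges by a double sum in which each edge occurs once, with its smaller
-- endpoint first, so that the order of summation can be exchanged.
edgeSum : ∀ {n} (G : Graph n) (c : Fin n × Fin n → ℕ) →
  ListAction.sum (List.map c (edges G)) ≡ sum λ i → sum λ j → if isEdge G i j then c (i , j) else 0
edgeSum {n} G c = trans (listSum-concatMap c (edgesFrom G) (allFin n)) (trans (listSum-tabulate from id) (sum-cong-≗ λ i →
  trans (listSum-concatMap c (edgeAt G i) (allFin n)) (trans (listSum-tabulate (at i) id) (sum-cong-≗ (point i)))))
  where
  at : Fin n → Fin n → ℕ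
  at i j = ListAction.sum (List.map c (edgeAt G i j))
  from : Fin n → ℕ
  from i = ListAction.sum (List.map c (edgesFrom G i))
  point : ∀ i j → at i j ≡ (if isEdge G i j then c (i , j) else 0)
  point i j with isEdge G i j
  ... | true = +-identityʳ _
  ... | false = refl

∈edges⇒adj : ∀ {n} (G : Graph n) {i j} → (i , j) ∈ edges G → adj G i j ≡ true
∈edges⇒adj {n} G {i} {j} e
  with a , e₁ ← satisfied (∈-concatMap⁻ (edgesFrom G) {xs = allFin n} e)
  with b , e₂ ← satisfied (∈-concatMap⁻ (edgeAt G a) {xs = allFin n} e₁)
  with isEdge G a b in eq
... | true with here refl ← e₂ = proj₂ (∧-elim {toℕ a <ᵇ toℕ b} eq)
... | false with () ← e₂

<ᵇ-false : ∀ {a b} → b ≤ a → (a <ᵇ b) ≡ false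
<ᵇ-false {a} {b} b≤a with a <ᵇ b in eq
... | false = refl
... | true = contradiction (<ᵇ-sound a b eq) (≤⇒≯ b≤a)

∑∑-distrib-+ : ∀ {n} (a b : Fin n → Fin n → ℕ) →
  (sum λ i → sum λ j → a i j + b i j) ≡ (sum λ i → sum λ j → a i j) + (sum λ i → sum λ j → b i j)
∑∑-distrib-+ a b = trans (sum-cong-≗ λ i → ∑-distrib-+ (a i) (b i)) (∑-distrib-+ (λ i → sum (a i)) (λ i → sum (b i)))

-- A matching of the bipartite double cover, halved.
module HalfMatching {n} (G : Graph n) (M : Rel n) (M⊆adj : ∀ i → M i ⊆ adj G i)
  (row≤1 : ∀ i → # (M i) ≤ 1) (col≤1 : ∀ j → # (flip M j) ≤ 1) where

  -- An edge of `G` has two copies in the double cover; `w` counts those in `M`.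
  w : Fin n × Fin n → ℕ
  w (i , j) = ⟦ M i j ⟧ + ⟦ M j i ⟧

  c : Fin n → Fin n → ℕ
  c i j = if isEdge G i j then w (i , j) else 0

  c-pair : ∀ i j → c i j + c j i ≤ w (i , j)
  c-pair i j with <-cmp (toℕ i) (toℕ j)
  ... | tri< lt _ _ rewrite <ᵇ-true lt | <ᵇ-false (<⇒≤ lt) with adj G i j
  ...   | true = ≤-reflexive (+-identityʳ _)
  ...   | false = z≤n
  c-pair i j | tri≈ _ eq _ rewrite <ᵇ-false (≤-reflexive eq) | <ᵇ-false (≤-reflexive (≡.sym eq)) = z≤n
  c-pair i j | tri> _ _ gt rewrite <ᵇ-true gt | <ᵇ-false (<⇒≤ gt) with adj G j i
  ...   | true = ≤-reflexive (+-comm ⟦ M j i ⟧ _)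
  ...   | false = z≤n

  -- The entries of `M` above the diagonal, and those below it moved to the transposed position. The
  -- diagonal of `M` is empty since `G` has no loops.
  upper lower : Fin n → Fin n → ℕ
  upper i j = if toℕ i <ᵇ toℕ j then ⟦ M i j ⟧ else 0
  lower i j = if toℕ i <ᵇ toℕ j then ⟦ M j i ⟧ else 0

  split-≤c : ∀ i j → upper i j + lower i j ≤ c i j
  split-≤c i j with toℕ i <ᵇ toℕ j
  ... | false = z≤n
  ... | true with adj G i j in eq
  ...   | true = ≤-refl
  ...   | false with M i j in m | M j i in m′
  ...     | false | false = z≤n
  ...     | true  | _     = case trans (≡.sym (M⊆adj i j m)) eq of λ ()
  ...     | false | true  = case trans (≡.sym (M⊆adj j i m′)) (trans (Graph.sym G j i) eq) of λ ()

  M≤split : ∀ i j → ⟦ M i j ⟧ ≤ upper i j + lower j i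
  M≤split i j with <-cmp (toℕ i) (toℕ j)
  ... | tri< lt _ _ rewrite <ᵇ-true lt = m≤m+n _ _
  ... | tri> _ _ gt rewrite <ᵇ-true gt = m≤n+m _ _
  ... | tri≈ _ eq _ with refl ← toℕ-injective eq with M i i in m
  ...   | false = z≤n
  ...   | true = case trans (≡.sym (M⊆adj i i m)) (irrefl G i) of λ ()

  total : ∥ M ∥ ≤ ListAction.sum (List.map w (edges G))
  total = begin
    (sum λ i → sum λ j → ⟦ M i j ⟧)                                    ≤⟨ (sum-mono λ i → sum-mono λ j → M≤split i j) ⟩
    (sum λ i → sum λ j → upper i j + lower j i)                        ≡⟨ ∑∑-distrib-+ upper (flip lower) ⟩
    (sum λ i → sum λ j → upper i j) + (sum λ i → sum λ j → lower j i)  ≡⟨ cong ((sum λ i → sum λ j → upper i j) +_) (∑-comm lower) ⟨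
    (sum λ i → sum λ j → upper i j) + (sum λ i → sum λ j → lower i j)  ≡⟨ ∑∑-distrib-+ upper lower ⟨
    (sum λ i → sum λ j → upper i j + lower i j)                        ≤⟨ (sum-mono λ i → sum-mono λ j → split-≤c i j) ⟩
    (sum λ i → sum λ j → c i j)                                        ≡⟨ edgeSum G w ⟨
    ListAction.sum (List.map w (edges G))                              ∎
    where
    open ≤-Reasoning

  -- The copies in `M` of edges at `x` are the entries of row `x` and of column `x`, at most one in
  -- each. Halving gives weight at most 1 at `x`.
  at : ∀ x → ListAction.sum (List.map w (filterᵇ (incident x) (edges G))) ≤ 2
  at x = begin
    ListAction.sum (List.map w (filterᵇ (incident x) (edges G)))           ≡⟨ listSum-filterᵇ w (incident x) (edges G) ⟩
    ListAction.sum (List.map w′ (edges G))                                 ≡⟨ edgeSum G w′ ⟩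
    (sum λ i → sum λ j → if isEdge G i j then w′ (i , j) else 0)           ≤⟨ (sum-mono λ i → sum-mono λ j → point i j) ⟩
    (sum λ i → sum λ j → fst i j + snd i j)                                ≡⟨ ∑∑-distrib-+ fst snd ⟩
    (sum λ i → sum λ j → fst i j) + (sum λ i → sum λ j → snd i j)          ≡⟨ cong₂ _+_ (∑-comm fst) refl ⟩
    (sum λ j → sum λ i → fst i j) + (sum λ i → sum λ j → snd i j)          ≡⟨ cong₂ _+_ (sum-cong-≗ λ j → sum-point (λ i → c i j) x) (sum-cong-≗ λ i → sum-point (c i) x) ⟩
    (sum λ j → c x j) + (sum λ j → c j x)                                  ≡⟨ ∑-distrib-+ (c x) (λ j → c j x) ⟨
    (sum λ j → c x j + c j x)                                              ≤⟨ sum-mono (c-pair x) ⟩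
    (sum λ j → ⟦ M x j ⟧ + ⟦ M j x ⟧)                                      ≡⟨ ∑-distrib-+ (λ j → ⟦ M x j ⟧) (λ j → ⟦ M j x ⟧) ⟩
    # (M x) + # (flip M x)                                                 ≤⟨ +-mono-≤ (row≤1 x) (col≤1 x) ⟩
    2                                                                      ∎
    where
    open ≤-Reasoning
    w′ : Fin n × Fin n → ℕ
    w′ e = if incident x e then w e else 0
    fst snd : Fin n → Fin n → ℕ
    fst i j = if toℕ i ≡ᵇ toℕ x then c i j else 0
    snd i j = if toℕ j ≡ᵇ toℕ x then c i j else 0
    point : ∀ i j → (if isEdge G i j then w′ (i , j) else 0) ≤ fst i j + snd i j
    point i j with isEdge G i j
    ... | false = z≤n
    ... | true with toℕ i ≡ᵇ toℕ x | toℕ j ≡ᵇ toℕ x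
    ...   | true  | _     = m≤m+n _ _
    ...   | false | true  = ≤-refl
    ...   | false | false = z≤n

  f : Fin n × Fin n → ℚ
  f = half ∘ w

  f-fractional : FracMatching G f
  -- `half 0` and `half 2` evaluate to `0ℚ` and `1ℚ`.
  f-fractional = (λ e _ → half-mono 0 (w e) z≤n , half-mono (w e) 2 (w≤2 e)) ,
    λ x → ℚ.≤-trans (ℚ.≤-reflexive (sumℚ-half w (filterᵇ (incident x) (edges G)))) (half-mono _ 2 (at x))
    where
    w≤2 : ∀ e → w e ≤ 2
    w≤2 (i , j) = +-mono-≤ (⟦⟧≤1 (M i j)) (⟦⟧≤1 (M j i))

  ∥M∥≤2ν* : ∀ k → FracMatchingNumber G (half k) → ∥ M ∥ ≤ k
  ∥M∥≤2ν* k (_ , max) = ≤-trans total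
    (half-cancel _ k (ℚ.≤-trans (ℚ.≤-reflexive (≡.sym (sumℚ-half w (edges G)))) (max f f-fractional)))

-- Weak duality with vertex covers

module _ {A : Set} (f : A → ℚ) where

  weight : List A → ℚ
  weight xs = sumℚ (List.map f xs)

  weight-partition : ∀ p xs → weight xs ≡ weight (filterᵇ p xs) ℚ.+ weight (filterᵇ (not ∘ p) xs)
  weight-partition p [] = refl
  weight-partition p (x ∷ xs) with p x
  ... | true = trans (cong (f x ℚ.+_) (weight-partition p xs)) (≡.sym (ℚ.+-assoc (f x) _ _))
  ... | false = trans (cong (f x ℚ.+_) (weight-partition p xs))
    (x∙yz≈y∙xz (f x) (weight (filterᵇ p xs)) _)

  -- Discarding nonnegative weights cannot increase a sum; this preserves the vertex constraints
  -- when edges are removed.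
  weight-filterᵇ-≤ : ∀ p q xs → (∀ x → x ∈ xs → 0ℚ ℚ.≤ f x) → weight (filterᵇ q (filterᵇ p xs)) ℚ.≤ weight (filterᵇ q xs)
  weight-filterᵇ-≤ p q [] _ = ℚ.≤-refl
  weight-filterᵇ-≤ p q (x ∷ xs) nn with ih ← weight-filterᵇ-≤ p q xs (λ y → nn y ∘ there) | p x
  ... | true with q x
  ...   | true = ℚ.+-monoʳ-≤ (f x) ih
  ...   | false = ih
  weight-filterᵇ-≤ p q (x ∷ xs) nn | false with q x
  ...   | true = ℚ.≤-trans (ℚ.≤-reflexive (≡.sym (ℚ.+-identityˡ _))) (ℚ.+-mono-≤ (nn x (here refl)) ih)
  ...   | false = ih

-- Induction on the cover: the edges at its first vertex weigh at most 1, and the edges not at that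
-- vertex are covered by the rest.
weight≤cover : ∀ {n} (f : Fin n × Fin n → ℚ) xs es →
  (∀ e → e ∈ es → 0ℚ ℚ.≤ f e) → (∀ x → weight f (filterᵇ (incident x) es) ℚ.≤ 1ℚ) →
  (∀ e → e ∈ es → ∃ λ x → x ∈ xs × incident x e ≡ true) → weight f es ℚ.≤ half (length xs * 2)
weight≤cover f [] [] _ _ _ = ℚ.≤-refl
weight≤cover f [] (e ∷ es) _ _ cov with _ , () , _ ← cov e (here refl)
weight≤cover f (x ∷ xs) es nn ≤1 cov = begin
  weight f es                                                ≡⟨ weight-partition f (incident x) es ⟩
  weight f (filterᵇ (incident x) es) ℚ.+ weight f es′        ≤⟨ ℚ.+-mono-≤ (≤1 x) (weight≤cover f xs es′ (λ e → nn e ∘ old) ≤1′ cov′) ⟩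
  half 2 ℚ.+ half (length xs * 2)                            ≡⟨ half-+ 2 (length xs * 2) ⟩
  half (length (x ∷ xs) * 2)                                 ∎
  where
  open ℚ.≤-Reasoning
  es′ : List _
  es′ = filterᵇ (not ∘ incident x) es
  old : ∀ {e} → e ∈ es′ → e ∈ es
  old = proj₁ ∘ ∈-filter⁻ (T? ∘ not ∘ incident x)
  ≤1′ : ∀ y → weight f (filterᵇ (incident y) es′) ℚ.≤ 1ℚ
  ≤1′ y = ℚ.≤-trans (weight-filterᵇ-≤ f (not ∘ incident x) (incident y) es nn) (≤1 y)
  cov′ : ∀ e → e ∈ es′ → ∃ λ y → y ∈ xs × incident y e ≡ true
  cov′ e m with cov e (old m)
  ... | y , there y∈ , inc = y , y∈ , inc
  ... | y , here refl , inc = contradiction inc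
    (not-elim (Equivalence.to T-≡ (proj₂ (∈-filter⁻ (T? ∘ not ∘ incident x) {xs = es} m))))

length-filterᵇ-tabulate : ∀ {n} {A : Set} (p : A → Bool) (h : Fin n → A) → length (filterᵇ p (List.tabulate h)) ≡ # (p ∘ h)
length-filterᵇ-tabulate {zero} p h = refl
length-filterᵇ-tabulate {suc n} p h with p (h zero)
... | true = cong suc (length-filterᵇ-tabulate p (h ∘ suc))
... | false = length-filterᵇ-tabulate p (h ∘ suc)

-- Weak duality applied to a fractional matching that attains ν*, with both sides doubled.
ν*≤vertexCover : ∀ {n} (G : Graph n) k → FracMatchingNumber G (half k) → (V : VSet n) →
  (∀ i j → adj G i j ≡ true → V i ≡ true ⊎ V j ≡ true) → k ≤ # V * 2
ν*≤vertexCover {n} G k ((f , (range , ≤1) , value) , _) V cov = half-cancel k (# V * 2)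
  (subst (ℚ._≤ half (# V * 2)) value (ℚ.≤-trans
    (weight≤cover f (filterᵇ V (allFin n)) (edges G) (λ e → proj₁ ∘ range e) ≤1 cov′)
    (ℚ.≤-reflexive (cong (λ m → half (m * 2)) (length-filterᵇ-tabulate V id)))))
  where
  listed : ∀ {x} → V x ≡ true → x ∈ filterᵇ V (allFin n)
  listed {x} p = ∈-filter⁺ (T? ∘ V) (∈-allFin x) (Equivalence.from T-≡ p)
  cov′ : ∀ e → e ∈ edges G → ∃ λ x → x ∈ filterᵇ V (allFin n) × incident x e ≡ true
  cov′ (i , j) m with cov i j (∈edges⇒adj G m)
  ... | inj₁ p = i , listed p , ∨-introˡ (≡ᵇ-refl (toℕ i))
  ... | inj₂ p = j , listed p , ∨-introʳ {toℕ i ≡ᵇ toℕ j} (≡ᵇ-refl (toℕ j))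

-- The half-integral vertex cover

-- König's cover read as vertex weights on `G`: 1 on `V₁`, ½ on the rest of `U`, and 0 on `V₀`, with
-- total (`# A + # B`)/2.
module HalfIntegralCover {n} (G : Graph n) (k : ℕ) (ν* : FracMatchingNumber G (half k)) (K : König (adj G)) where

  open König K

  V₁ V₀ U : VSet n
  V₁ = A ∩ B
  U = A ∪ B
  V₀ = ∁ U

  -- As `x` lies in neither `A` nor `B`, the two copies of the edge `x y` must be covered at `y`,
  -- one by `B` and the other by `A`.
  V₀-nbrs : ∀ x → V₀ x ≡ true → adj G x ⊆ V₁
  V₀-nbrs x x∈V₀ y xy with cover x y xy | cover y x (trans (Graph.sym G y x) xy)
  ... | inj₁ p | _      = contradiction (∨-introˡ p) (not-elim x∈V₀)
  ... | inj₂ _ | inj₂ q = contradiction (∨-introʳ {A x} q) (not-elim x∈V₀)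
  ... | inj₂ p | inj₁ q = ∧-intro q p

  V₁+U≤k : # V₁ + # U ≤ k
  V₁+U≤k = ≤-trans (≤-reflexive (#-∩-∪ A B)) (≤-trans tight (HalfMatching.∥M∥≤2ν* G M M⊆E row≤1 col≤1 k ν*))

  V₁⊆U : V₁ ⊆ U
  V₁⊆U i p = ∨-introˡ (proj₁ (∧-elim {A i} p))

  2V₁≤k : # V₁ + # V₁ ≤ k
  2V₁≤k = ≤-trans (+-monoʳ-≤ (# V₁) (#-mono V₁⊆U)) V₁+U≤k

  V₀-big : # V₁ + n ≤ k + # V₀
  V₀-big = begin
    # V₁ + n                  ≡⟨ cong (# V₁ +_) (#-∁ U) ⟨
    # V₁ + (# U + # V₀)       ≡⟨ +-assoc (# V₁) _ _ ⟨
    # V₁ + # U + # V₀         ≤⟨ +-monoˡ-≤ (# V₀) V₁+U≤k ⟩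
    k + # V₀                  ∎
    where open ≤-Reasoning

  -- With at most one vertex of weight ½, the vertices of weight 1 cover all edges.
  U≤1+V₁⇒cover : # U ≤ suc (# V₁) → ∀ i j → adj G i j ≡ true → V₁ i ≡ true ⊎ V₁ j ≡ true
  U≤1+V₁⇒cover U≤ i j ij with V₁ i in ei | V₁ j in ej
  ... | true | _ = inj₁ refl
  ... | false | true = inj₂ refl
  ... | false | false = contradiction U≤ (<⇒≱ (begin
    suc (suc (# V₁))            ≤⟨ s≤s (s≤s (#-mono V₁⊆)) ⟩
    suc (suc (# (U − i − j)))   ≡⟨ cong suc (#-−-∈ (U − i) j (−-intro {A = U} j∈U j≢i)) ⟨
    suc (# (U − i))             ≡⟨ #-−-∈ U i i∈U ⟨
    # U                         ∎))
    where
    open ≤-Reasoning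
    j≢i : j ≢ i
    j≢i refl = case trans (≡.sym ij) (irrefl G i) of λ ()
    i∈U : U i ≡ true
    i∈U = decidable-stable (U i ≟ᵇ true) λ ne → case trans (≡.sym (V₀-nbrs i (not-intro ne) j ij)) ej of λ ()
    j∈U : U j ≡ true
    j∈U = decidable-stable (U j ≟ᵇ true) λ ne → case trans (≡.sym (V₀-nbrs j (not-intro ne) i (trans (Graph.sym G j i) ij))) ei of λ ()
    V₁⊆ : V₁ ⊆ U − i − j
    V₁⊆ x p = −-intro {A = U − i} (−-intro {A = U} (V₁⊆U x p) λ { refl → case trans (≡.sym p) ei of λ () })
      λ { refl → case trans (≡.sym p) ej of λ () }

-- Assembling the bounds

k+1+c+t : ∀ k c t → k + suc (c + t) ≡ t + suc (k + c)
k+1+c+t = solve-∀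

module Bound (n k c : ℕ) (n≡ : n ≡ suc (k + c)) (δ p : ℕ) (G : Graph n) (ν* : FracMatchingNumber G (half k)) (minDeg : MinDegree G δ)
  (K : König (adj G)) where

  open HalfIntegralCover G k ν* K

  t : ℕ
  t = # V₁

  c+t<V₀ : suc (c + t) ≤ # V₀
  c+t<V₀ = +-cancelˡ-≤ k _ _ (≤-trans (≤-reflexive (trans (k+1+c+t k c t) (cong (t +_) (≡.sym n≡)))) V₀-big)

  -- `V₀` is nonempty, and any vertex in it has at least `δ` neighbours, all in `V₁`.
  δ≤t : δ ≤ t
  δ≤t = let x , x∈V₀ = 0<#⇒∈ V₀ (≤-trans (s≤s z≤n) c+t<V₀) in
    ≤-trans (proj₁ minDeg x) (≤-trans (≤-reflexive (deg≡# G x)) (#-mono (V₀-nbrs x x∈V₀)))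

  -- Convexity of `φ` on the interval from `δ` to `T`; the cliques through a vertex of degree `δ`
  -- contribute a term independent of `t`, which is added to both sides of the maximum.
  bound : ∀ T → t ≤ T → T + T ≤ k → NK (2 + p) G ≤ g (2 + p) n k δ δ ⊔ g (2 + p) n k δ T
  bound T t≤T 2T≤k = begin
    NK (2 + p) G                                                     ≤⟨ upper ⟩
    φ k c (suc p) t + Cδ                                             ≤⟨ +-monoˡ-≤ Cδ (Convexity.φ≤max-endpoints k c p (≤⇒≤′ δ≤t) t≤T T≤k) ⟩
    (φ k c (suc p) δ ⊔ φ k c (suc p) T) + Cδ                         ≡⟨ +-distribʳ-⊔ Cδ (φ k c (suc p) δ) _ ⟩
    (φ k c (suc p) δ + Cδ) ⊔ (φ k c (suc p) T + Cδ)                  ≤⟨ ⊔-mono-≤ lowerδ lowerT ⟩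
    g (2 + p) n k δ δ ⊔ g (2 + p) n k δ T    ∎
    where
    open ≤-Reasoning
    Cδ : ℕ
    Cδ = δ C suc p
    T≤k : T ≤ k
    T≤k = ≤-trans (m≤m+n T T) 2T≤k
    δ≤T : δ ≤ T
    δ≤T = ≤-trans δ≤t t≤T
    upper : NK (2 + p) G ≤ φ k c (suc p) t + Cδ
    upper = let v , deg≡δ = proj₂ minDeg in subst (λ d → NK (2 + p) G ≤ φ k c (suc p) t + d C suc p) deg≡δ
      (NK-upper n≡ G (suc p) V₀ V₁ V₀-nbrs (≤-trans t≤T T≤k) c+t<V₀ v)
    lowerδ : φ k c (suc p) δ + Cδ ≤ g (2 + p) n k δ δ
    lowerδ = subst (λ n → φ k c (suc p) δ + Cδ ≤ g (2 + p) n k δ δ) (≡.sym n≡)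
      (LowerBound.g-lower k c δ δ ≤-refl (≤-trans (+-mono-≤ δ≤T δ≤T) 2T≤k) (suc p))
    lowerT : φ k c (suc p) T + Cδ ≤ g (2 + p) n k δ T
    lowerT = subst (λ n → φ k c (suc p) T + Cδ ≤ g (2 + p) n k δ T) (≡.sym n≡)
      (LowerBound.g-lower k c δ T δ≤T 2T≤k (suc p))

  2*a≡a+a : ∀ a → 2 * a ≡ a + a
  2*a≡a+a a = cong (a +_) (+-identityʳ a)

  even-bound : ∀ m → k ≡ 2 * m → NK (2 + p) G ≤ g (2 + p) n k δ δ ⊔ g (2 + p) n k δ m
  even-bound m k≡ = bound m
    (*-cancelˡ-≤ 2 (≤-trans (≤-reflexive (2*a≡a+a t)) (≤-trans 2V₁≤k (≤-reflexive k≡))))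
    (≤-reflexive (≡.sym (trans k≡ (2*a≡a+a m))))

  module _ (m : ℕ) (k≡ : k ≡ 2 * m + 1) where

    k≡m+[1+m] : k ≡ m + suc m
    k≡m+[1+m] = trans k≡ (trans (+-comm (2 * m) 1) (trans (cong suc (2*a≡a+a m)) (≡.sym (+-suc m m))))

    -- Otherwise V₁ would cover all edges, and ν* ≤ m.
    t<m : t < m
    t<m = ≤∧≢⇒< t≤m λ t≡m → <⇒≱ (≤-reflexive (1+t*2≡k t≡m))
      (ν*≤vertexCover G k ν* V₁ (U≤1+V₁⇒cover (+-cancelˡ-≤ t _ _
        (≤-trans V₁+U≤k (≤-reflexive (trans k≡m+[1+m] (cong (λ a → a + suc a) (≡.sym t≡m))))))))
      where
      t≤m : t ≤ m
      t≤m = ≮⇒≥ λ m<t → <⇒≱ (+-mono-<-≤ m<t m<t) (≤-trans 2V₁≤k (≤-reflexive k≡m+[1+m]))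
      1+t*2≡k : t ≡ m → suc (t * 2) ≡ k
      1+t*2≡k t≡m = trans (cong (λ a → suc (a * 2)) t≡m)
        (trans (cong suc (*-comm m 2)) (trans (+-comm 1 (2 * m)) (≡.sym k≡)))

    -- With s = m + ½, the endpoint s - 3/2 is m - 1. The subtraction is exact because `t<m` makes
    -- `m` positive.
    odd-bound : NK (2 + p) G ≤ g (2 + p) n k δ δ ⊔ g (2 + p) n k δ (m ∸ 1)
    odd-bound = bound (m ∸ 1) (∸-monoˡ-≤ 1 t<m)
      (≤-trans (+-mono-≤ (m∸n≤m m 1) (≤-trans (m∸n≤m m 1) (n≤1+n m))) (≤-reflexive (≡.sym k≡m+[1+m])))

open import Data.Integer using (+_)

theorem1p6 : (n k δ ℓ : ℕ) → 1 ≤ δ → 2 ≤ ℓ → 5 ≤ k + 1 → k + 1 ≤ n →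
    (G : Graph n) → FracMatchingNumber G ((+ k) / 2) → MinDegree G δ →
    (∀ m → k ≡ 2 * m → NK ℓ G ≤ g ℓ n k δ δ ⊔ g ℓ n k δ m) ×
    (∀ m → k ≡ 2 * m + 1 → NK ℓ G ≤ g ℓ n k δ δ ⊔ g ℓ n k δ (m ∸ 1))
theorem1p6 n k δ (suc (suc p)) _ (s≤s (s≤s _)) _ k<n G ν* minDeg = even-bound , odd-bound
  where
  n≡ : n ≡ suc (k + (n ∸ (k + 1)))
  n≡ = trans (≡.sym (m+[n∸m]≡n k<n)) (cong (_+ (n ∸ (k + 1))) (+-comm k 1))
  open Bound n k (n ∸ (k + 1)) n≡ δ p G ν* minDeg (könig (adj G))
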